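{- It holds that $\mathbb{E}\left[\mathrm{OPT}^{\mathrm{(IP2)}}\right]\le(1+O(\epsilon))\,\mathrm{OPT}^{\mathrm{(IP)}}$, where the expectation is over the random choice of the offsets $\mathrm{off}_x,\mathrm{off}_y$ and the constant hidden in $O(\epsilon)$ is absolute.
   Context: Setting. Let $\epsilon\in(0,1)$ with $1/\epsilon\in\mathbb{N}$. There are $n$ jobs $J=\{1,\dots,n\}$, each with integral release time $r_j\ge 0$, processing time $p_j\ge1$ and weight $w_j\ge 1$. Standing assumptions: $\min_j r_j=0$, $\max_j r_j\le\sum_j p_j$, $\min_j p_j=1$, $\max_j p_j=P$, and $w_j\le O_\epsilon(n^2P)$. Put $T:=\max_j r_j+\sum_j p_j$. (IP) is the integer program with variables $x_{j,t}\in\{0,1\}$ ($j\in J$, $t\in\{r_j,\dots,T\}$): minimize $\sum_{j\in J}\sum_{t\ge r_j}w_jx_{j,t}$ subject to $\sum_{j: s\le r_j\le t}x_{j,t}p_j\ge\sum_{j:s\le r_j\le t}p_j-(t-s)$ for all integers $0\le s\le t\le T$, and $x_{j,t}\ge x_{j,t+1}$ for all $j\in J$, $t>r_j$ (with $t+1\le T$). $\mathrm{OPT}^{\mathrm{(IP)}}$ is its optimal value. Grid. Let $K:=(2/\epsilon)^{1/\epsilon}$ and let $\ell_{\max}$ be the minimal $k$ with $K^{k-2}\ge T$. The offsets are chosen independently and uniformly at random, $\mathrm{off}_y\in\{(2/\epsilon)^0,\dots,(2/\epsilon)^{1/\epsilon-1}\}$ and $\mathrm{off}_x\in\{ -K^{\ell_{\max}-1}+1,\dots,0\}$.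 Grid cells are half-open intervals: the unique cell of level $0$ is $[\mathrm{off}_x,\mathrm{off}_x+\mathrm{off}_yK^{\ell_{\max}})$, and each cell of level $\ell<\ell_{\max}$ is divided into $K$ equal-length child cells of level $\ell+1$. $\mathcal{C}$ is the set of all cells. For an interval $A=[a,b)$ write $\mathrm{beg}(A)=a$, $\mathrm{end}(A)=b$, $\mathrm{len}(A)=b-a$. Segments. For each job $j$ let $C_{\ell_{\max}}$ be the cell of level $\ell_{\max}$ containing $r_j$, and given $C_k$ let $C_{k-1}$ be the cell of level $k-1$ containing $\mathrm{end}(C_k)$, down to $C_0$. For $k\in\{\ell_{\max}-1,\dots,0\}$ subdivide $[\mathrm{end}(C_{k+1}),\mathrm{end}(C_k))$, and for $k=\ell_{\max}$ subdivide $[r_j,\mathrm{end}(C_{\ell_{\max}}))$, into half-open segments of length $\mathrm{len}(C_{k+2})$ if $k\le\ell_{\max}-2$ and of length $1$ if $k>\ell_{\max}-2$; these segments form $\mathrm{Seg}(j,C_k)$. For all other cells $\mathrm{Seg}(j,C)=\emptyset$. Let $\mathrm{Seg}(j)=\bigcup_{C\in\mathcal{C}}\mathrm{Seg}(j,C)$. The leftmost segment $S$ of $\mathrm{Seg}(j,C)$ has cost $c_{j,S}=w_j(\mathrm{end}(S)-r_j)$; every other $S'\in\mathrm{Seg}(j,C)$ has cost $c_{j,S'}=w_j\,\mathrm{len}(S')$. (IP2) is the integer program with variables $y_{j,S}\in\{0,1\}$ ($j\in J$, $S\in\mathrm{Seg}(j)$): minimize $\sum_{j\in J}\sum_{S\in\mathrm{Seg}(j)}c_{j,S}y_{j,S}$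 subject to $\sum_{j:s\le r_j\le t}\ \sum_{S\in\mathrm{Seg}(j):t\in S}y_{j,S}p_j\ge\sum_{j:s\le r_j\le t}p_j-(t-s)$ for all integers $0\le s\le t\le T$, and $y_{j,S}\ge y_{j,S'}$ for all $j\in J$, $C\in\mathcal{C}$, $S,S'\in\mathrm{Seg}(j,C)$ with $\mathrm{end}(S)<\mathrm{end}(S')$. $\mathrm{OPT}^{\mathrm{(IP2)}}$ is its optimal value; it depends on $\mathrm{off}_x,\mathrm{off}_y$. -}

module Defs where

open import Data.Bool.Base as Bool using (Bool; if_then_else_)
open import Data.Fin.Base using (Fin; toℕ)
open import Data.Integer.Base as ℤ using (ℤ; +_; 0ℤ; 1ℤ; -_; ∣_∣; _/ℕ_)
import Data.Integer.Properties as ℤ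
open import Data.List.Base using (List; map; foldr; filter; upTo; applyUpTo; allFin; cartesianProduct)
open import Data.List.Extrema.Nat using (max)
open import Data.List.Membership.Propositional using (_∈_)
open import Data.Nat.Base as ℕ using (ℕ; zero; suc; NonZero; NonTrivial; nonTrivial⇒nonZero)
open import Data.Nat.ListAction using (sum)
import Data.Nat.Properties as ℕ
open import Data.Product.Base using (∃-syntax; _×_; _,_; proj₂)
open import Data.Rational.Base as ℚ using (ℚ)
open import Relation.Binary.PropositionalEquality.Core using (_≡_)
open import Relation.Nullary.Decidable.Core using (Dec; does; _×-dec_)

∑ : {A : Set} → List A → (A → ℤ) → ℤ
∑ xs f = foldr ℤ._+_ 0ℤ (map f xs)

infix 5 ∑
syntax ∑ xs (λ x → e) = ∑[ x ∈ xs ] e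

val : Bool → ℤ
val b = if b then 1ℤ else 0ℤ

record MinimizationProblem : Set₁ where
  field
    Assignment : Set
    Feasible   : Assignment → Set
    cost       : Assignment → ℤ

IsOPT : MinimizationProblem → ℤ → Set
IsOPT Π v = (∃[ x ] Feasible x × cost x ≡ v) × (∀ x → Feasible x → v ℤ.≤ cost x)
  where open MinimizationProblem Π

IsLeast : (ℕ → Set) → ℕ → Set
IsLeast Q k = Q k × (∀ m → Q m → k ℕ.≤ m)

record Instance : Set where
  field
    n     : ℕ
    r p w : Fin n → ℕ

  J : List (Fin n)
  J = allFin n

  -- The default value 0 of max is irrelevant, as there is at least one job (see min-p).
  P : ℕ
  P = max 0 (map p J)

  rmax : ℕ
  rmax = max 0 (map r J)

  ∑p : ℕ
  ∑p = sum (map p J)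

  T : ℕ
  T = rmax ℕ.+ ∑p

  released : ℕ → ℕ → List (Fin n)
  released s t = filter (λ j → (s ℕ.≤? r j) ×-dec (r j ℕ.≤? t)) J

  demand : ℕ → ℕ → ℤ
  demand s t = (∑[ j ∈ released s t ] (+ p j)) ℤ.- (+ t ℤ.- + s)

-- κ is the constant (for the given ε) in the bound w_j ≤ O_ε(n²P).
record StandingAssumptions (κ : ℕ) (I : Instance) : Set where
  open Instance I
  field
    p≥1    : ∀ j → 1 ℕ.≤ p j
    w≥1    : ∀ j → 1 ℕ.≤ w j
    min-r  : ∃[ j ] r j ≡ 0
    max-r  : rmax ℕ.≤ ∑p
    min-p  : ∃[ j ] p j ≡ 1
    w≤κn²P : ∀ j → w j ℕ.≤ κ ℕ.* (n ℕ.^ 2 ℕ.* P)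

module _ (I : Instance) where
  open Instance I

  -- Only the values x j t with r j ≤ t ≤ T are variables of (IP); cost and
  -- constraints do not look at any others.
  IP : MinimizationProblem
  IP = record
    { Assignment = Fin n → ℕ → Bool
    ; Feasible   = λ x →
        (∀ s t → s ℕ.≤ t → t ℕ.≤ T →
           (∑[ j ∈ released s t ] (val (x j t) ℤ.* + p j)) ℤ.≥ demand s t)
        × (∀ j t → r j ℕ.< t → suc t ℕ.≤ T → x j (suc t) Bool.≤ x j t)
    ; cost       = λ x →
        ∑[ j ∈ J ] ∑[ t ∈ filter (r j ℕ.≤?_) (upTo (suc T)) ] (+ w j ℤ.* val (x j t))
    }

infix 4 _∋_ _∋?_

record Interval : Set where
  constructor [_,_⟩
  field
    beg end : ℤ

  len : ℤ
  len = end ℤ.- beg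

open Interval public

_∋_ : Interval → ℤ → Set
A ∋ t = beg A ℤ.≤ t × t ℤ.< end A

_∋?_ : ∀ A t → Dec (A ∋ t)
A ∋? t = (beg A ℤ.≤? t) ×-dec (t ℤ.<? end A)

-- All intervals subdivided below have a length that is a multiple of L.
subdivide : Interval → (L : ℕ) .{{_ : NonZero L}} → List Interval
subdivide A L =
  applyUpTo (λ i → [ beg A ℤ.+ + (i ℕ.* L) , beg A ℤ.+ + (suc i ℕ.* L) ⟩) (∣ len A ∣ ℕ./ L)

module _ (1/ε : ℕ) where

  2/ε : ℕ
  2/ε = 2 ℕ.* 1/ε

  K : ℕ
  K = 2/ε ℕ.^ 1/ε

-- K ^ (k - 2) ≥ T, with the possibly negative exponent cleared.
IsLMax : (1/ε T : ℕ) → ℕ → Set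
IsLMax 1/ε T = IsLeast (λ k → K 1/ε ℕ.^ k ℕ.≥ T ℕ.* K 1/ε ℕ.^ 2)

-- ε ∈ (0,1) with 1/ε ∈ ℕ means that 1/ε is a natural number greater than 1.
module _ (1/ε : ℕ) .{{_ : NonTrivial 1/ε}} where

  private instance
    1/ε≢0 : NonZero 1/ε
    1/ε≢0 = nonTrivial⇒nonZero 1/ε

    2/ε≢0 : NonZero (2/ε 1/ε)
    2/ε≢0 = ℕ.m*n≢0 2 1/ε

    K≢0 : NonZero (K 1/ε)
    K≢0 = ℕ.m^n≢0 (2/ε 1/ε) 1/ε

  ε : ℚ
  ε = 1ℤ ℚ./ 1/ε

  module _ (ℓmax : ℕ) where

    Offsets : Set
    Offsets = Fin (K 1/ε ℕ.^ (ℓmax ℕ.∸ 1)) × Fin 1/ε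

    -- off-x ranges over {-K^(ℓmax-1)+1, …, 0}.
    off-x : Offsets → ℤ
    off-x (a , _) = - (+ toℕ a)

    off-y : Offsets → ℕ
    off-y (_ , b) = 2/ε 1/ε ℕ.^ toℕ b

    𝔼 : (Offsets → ℤ) → ℚ
    𝔼 f = ∑ (cartesianProduct (allFin #x) (allFin 1/ε)) f ℚ./ (#x ℕ.* 1/ε)
      where
      #x = K 1/ε ℕ.^ (ℓmax ℕ.∸ 1)
      instance
        #x≢0 : NonZero #x
        #x≢0 = ℕ.m^n≢0 (K 1/ε) (ℓmax ℕ.∸ 1)
        #≢0 : NonZero (#x ℕ.* 1/ε)
        #≢0 = ℕ.m*n≢0 #x 1/ε

    -- Levels are given by their height h = ℓmax − ℓ, so the cell of level 0
    -- has height ℓmax.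
    module Grid (o : Offsets) where

      cellLen : ℕ → ℕ
      cellLen h = off-y o ℕ.* K 1/ε ℕ.^ h

      cellLen≢0 : ∀ h → NonZero (cellLen h)
      cellLen≢0 h = ℕ.m*n≢0 (off-y o) (K 1/ε ℕ.^ h)
        {{ℕ.m^n≢0 (2/ε 1/ε) (toℕ (proj₂ o))}} {{ℕ.m^n≢0 (K 1/ε) h}}

      -- Starting from [off-x , off-x + off-y K^ℓmax⟩ and dividing every cell into
      -- K equal parts, the cells of height h are cell h i for 0 ≤ i < K^(ℓmax-h).
      cell : ℕ → ℤ → Interval
      cell h i = [ off-x o ℤ.+ i ℤ.* + cellLen h , off-x o ℤ.+ (i ℤ.+ 1ℤ) ℤ.* + cellLen h ⟩

      -- The cell of height h containing the point q; /ℕ rounds down.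
      cellAt : ℕ → ℤ → Interval
      cellAt h q = cell h ((q ℤ.- off-x o) /ℕ cellLen h)
        where instance _ = cellLen≢0 h

      -- Length of the segments in Seg(j, C_{ℓmax-h}): len(C_{k+2}) for
      -- k = ℓmax - h ≤ ℓmax - 2, and 1 for larger k.
      segLen : ℕ → ℕ
      segLen 0             = 1
      segLen 1             = 1
      segLen (suc (suc h)) = cellLen h

      segLen≢0 : ∀ h → NonZero (segLen h)
      segLen≢0 0             = _
      segLen≢0 1             = _
      segLen≢0 (suc (suc h)) = cellLen≢0 h

      module Segments (I : Instance) where
        open Instance I

        -- C j h is the cell C_{ℓmax-h} of job j. Since K^(ℓmax-2) ≥ T and
        -- K ≥ 16, end (C j h) for h < ℓmax lies in the cell of level 0, so
        -- these are indeed cells of the grid.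
        C : Fin n → ℕ → Interval
        C j zero    = cellAt 0 (+ r j)
        C j (suc h) = cellAt (suc h) (end (C j h))

        -- The part of C j h that is subdivided into segments.
        part : Fin n → ℕ → Interval
        part j zero    = [ + r j         , end (C j 0) ⟩
        part j (suc h) = [ end (C j h) , end (C j (suc h)) ⟩

        -- Seg(j, C j h). The sets Seg(j, C) of all other cells C are empty, and
        -- Seg(j) is the disjoint union of the Seg j h for 0 ≤ h ≤ ℓmax.
        Seg : Fin n → ℕ → List Interval
        Seg j h = subdivide (part j h) (segLen h)
          where instance _ = segLen≢0 h

        heights : List ℕ
        heights = upTo (suc ℓmax)

        -- The leftmost segment of Seg j h is the one starting where part j h starts.
        segCost : Fin n → ℕ → Interval → ℤ
        segCost j h S =
          + w j ℤ.* (if does (beg S ℤ.≟ beg (part j h)) then end S ℤ.- + r j else len S)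

  module _ (I : Instance) (ℓmax : ℕ) (o : Offsets ℓmax) where
    open Instance I
    open Grid.Segments ℓmax o I

    -- Only the values y j S with S a segment of j are variables of (IP2).
    IP2 : MinimizationProblem
    IP2 = record
      { Assignment = Fin n → Interval → Bool
      ; Feasible   = λ y →
          (∀ s t → s ℕ.≤ t → t ℕ.≤ T →
             (∑[ j ∈ released s t ] ∑[ h ∈ heights ] ∑[ S ∈ filter (_∋? + t) (Seg j h) ]
                (val (y j S) ℤ.* + p j)) ℤ.≥ demand s t)
          × (∀ j h → h ∈ heights → ∀ S S′ → S ∈ Seg j h → S′ ∈ Seg j h →
             end S ℤ.< end S′ → y j S′ Bool.≤ y j S)
      ; cost       = λ y →
          ∑[ j ∈ J ] ∑[ h ∈ heights ] ∑[ S ∈ Seg j h ] (segCost j h S ℤ.* val (y j S))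
      }

-- From an optimal schedule x, in which job j is unfinished during [r_j, r_j + m_j), take
-- the segments that begin before r_j + m_j. Let e_h be the distance from r_j to the end of
-- the cell C_{ℓmax-h} of j. Up to the factor w_j, each part that ends before r_j + m_j
-- costs its e_h < m_j, and the next part costs m_j plus a rounding error that is at most
-- the e_h of the preceding part. Hence the cost is at most m_j + 2 Σ [e_h < m_j] e_h.
-- For a cell length L, e_h ≤ 2L always holds, whereas e_h < m_j requires a multiple of L
-- within distance m_j, so that over off_x the expectation of [e_h < m_j] e_h is
-- O(min(L, m_j²/L)). As off_y and h vary, L runs through all powers of 2/ε once, and the
-- sum of min(L, m_j²/L) over these powers is O(m_j). Averaging over the 1/ε choices of
-- off_y gives O(ε m_j).
module Submission where

module Arithmetic where

  open import Data.Nat.Base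
  open import Data.Nat.Properties
  open import Data.Nat.DivMod
  open import Data.Nat.Divisibility using (_∣_; divides; ∣⇒≤; ∣-refl; ∣-trans)
  open import Data.Nat.Tactic.RingSolver using (solve-∀)
  open import Data.Product.Base using (_×_; _,_)
  open import Data.Sum.Base using (_⊎_; inj₁; inj₂)
  open import Data.Bool.Base using (if_then_else_)
  open import Relation.Binary.PropositionalEquality
  open import Relation.Nullary.Decidable using (does; yes; no; dec-true; dec-false)

  -- Finite sums of natural numbers, up to a two-sided geometric sum.

  Σ< : ℕ → (ℕ → ℕ) → ℕ
  Σ< zero    f = 0
  Σ< (suc n) f = Σ< n f + f n

  Σ<-mono : ∀ n {f g : ℕ → ℕ} → (∀ i → i < n → f i ≤ g i) → Σ< n f ≤ Σ< n g
  Σ<-mono zero    f≤g = z≤n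
  Σ<-mono (suc n) f≤g = +-mono-≤ (Σ<-mono n (λ i i<n → f≤g i (m<n⇒m<1+n i<n))) (f≤g n (n<1+n n))

  Σ<-cong : ∀ n {f g : ℕ → ℕ} → (∀ i → i < n → f i ≡ g i) → Σ< n f ≡ Σ< n g
  Σ<-cong n f≡g = ≤-antisym (Σ<-mono n (λ i i<n → ≤-reflexive (f≡g i i<n)))
                            (Σ<-mono n (λ i i<n → ≤-reflexive (sym (f≡g i i<n))))

  Σ<-monoʳ-≤ : ∀ f {m n} → m ≤ n → Σ< m f ≤ Σ< n f
  Σ<-monoʳ-≤ f {m} {n} m≤n with ≤⇒≤′ m≤n
  ... | ≤′-refl     = ≤-refl
  ... | ≤′-step m≤k = ≤-trans (Σ<-monoʳ-≤ f (≤′⇒≤ m≤k)) (m≤m+n _ _)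

  Σ<-const : ∀ n c → Σ< n (λ _ → c) ≡ n * c
  Σ<-const zero    c = refl
  Σ<-const (suc n) c = trans (cong (_+ c) (Σ<-const n c)) (+-comm (n * c) c)

  Σ<-≤-* : ∀ n {f : ℕ → ℕ} c → (∀ i → i < n → f i ≤ c) → Σ< n f ≤ n * c
  Σ<-≤-* n c f≤c = ≤-trans (Σ<-mono n f≤c) (≤-reflexive (Σ<-const n c))

  Σ<-distrib-+ : ∀ n (f g : ℕ → ℕ) → Σ< n (λ i → f i + g i) ≡ Σ< n f + Σ< n g
  Σ<-distrib-+ zero    f g = refl
  Σ<-distrib-+ (suc n) f g = begin
    Σ< n (λ i → f i + g i) + (f n + g n)  ≡⟨ cong (_+ (f n + g n)) (Σ<-distrib-+ n f g) ⟩
    Σ< n f + Σ< n g + (f n + g n)         ≡⟨ interchange (Σ< n f) (Σ< n g) (f n) (g n) ⟩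
    Σ< n f + f n + (Σ< n g + g n)         ∎
    where
    open ≡-Reasoning
    interchange : ∀ a b c d → a + b + (c + d) ≡ a + c + (b + d)
    interchange = solve-∀

  Σ<-distrib-* : ∀ n c (f : ℕ → ℕ) → Σ< n (λ i → c * f i) ≡ c * Σ< n f
  Σ<-distrib-* zero    c f = sym (*-zeroʳ c)
  Σ<-distrib-* (suc n) c f =
    trans (cong (_+ c * f n) (Σ<-distrib-* n c f)) (sym (*-distribˡ-+ c (Σ< n f) (f n)))

  Σ<-comm : ∀ m n (f : ℕ → ℕ → ℕ) → Σ< m (λ i → Σ< n (f i)) ≡ Σ< n (λ k → Σ< m (λ i → f i k))
  Σ<-comm zero    n f = sym (trans (Σ<-const n 0) (*-zeroʳ n))
  Σ<-comm (suc m) n f = trans (cong (_+ Σ< n (f m)) (Σ<-comm m n f))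
                              (sym (Σ<-distrib-+ n (λ k → Σ< m (λ i → f i k)) (f m)))

  Σ<-+ : ∀ m n (f : ℕ → ℕ) → Σ< (m + n) f ≡ Σ< m f + Σ< n (λ i → f (m + i))
  Σ<-+ m zero    f = trans (cong (λ k → Σ< k f) (+-identityʳ m)) (sym (+-identityʳ _))
  Σ<-+ m (suc n) f = begin
    Σ< (m + suc n) f                                  ≡⟨ cong (λ k → Σ< k f) (+-suc m n) ⟩
    Σ< (m + n) f + f (m + n)                          ≡⟨ cong (_+ f (m + n)) (Σ<-+ m n f) ⟩
    Σ< m f + Σ< n (λ i → f (m + i)) + f (m + n)       ≡⟨ +-assoc (Σ< m f) _ _ ⟩
    Σ< m f + (Σ< n (λ i → f (m + i)) + f (m + n))     ∎
    where open ≡-Reasoning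

  Σ<-* : ∀ m n (f : ℕ → ℕ) → Σ< (m * n) f ≡ Σ< m (λ h → Σ< n (λ i → f (h * n + i)))
  Σ<-* zero    n f = refl
  Σ<-* (suc m) n f = begin
    Σ< (n + m * n) f                                  ≡⟨ cong (λ k → Σ< k f) (+-comm n (m * n)) ⟩
    Σ< (m * n + n) f                                  ≡⟨ Σ<-+ (m * n) n f ⟩
    Σ< (m * n) f + Σ< n (λ i → f (m * n + i))         ≡⟨ cong (_+ Σ< n (λ i → f (m * n + i))) (Σ<-* m n f) ⟩
    Σ< (suc m) (λ h → Σ< n (λ i → f (h * n + i)))     ∎
    where open ≡-Reasoning

  -- With D^a ≤ m < D^(a+1), the terms k ≤ a sum up to at most 2Qm by the first bound
  -- and the others by the second one; 2Qm² is the geometric tail still to come.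
  Σ<-two-sided-geometric : ∀ D → 2 ≤ D → ∀ Q m → 1 ≤ m → (B : ℕ → ℕ) →
    (∀ k → B k ≤ Q * D ^ k) → (∀ k → B k * D ^ k ≤ Q * (m * m)) →
    ∀ M → Σ< M B ≤ 4 * (Q * m)
  Σ<-two-sided-geometric D 2≤D Q m 1≤m B B≤ BD≤ M = conclude M (invariant M)
    where
    open ≤-Reasoning

    Invariant : ℕ → Set
    Invariant k = (D ^ k ≤ m × Σ< k B ≤ Q * D ^ k)
                ⊎ (m < D ^ k × Σ< k B * D ^ k + 2 * (Q * (m * m)) ≤ 4 * (Q * m) * D ^ k)

    regroup₁ : ∀ Q m x → 2 * (Q * m) * x + 2 * (Q * m) * x ≡ 4 * (Q * m) * x
    regroup₁ = solve-∀
    regroup₂ : ∀ Q m → 2 * (Q * (m * m)) ≡ 2 * (Q * m) * m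
    regroup₂ = solve-∀
    regroup₃ : ∀ D s b x q → (s + b) * (D * x) + 2 * q ≡ D * (s * x) + D * (b * x) + 2 * q
    regroup₃ = solve-∀
    regroup₄ : ∀ D s q → D * s + D * q + D * q ≡ D * (s + 2 * q)
    regroup₄ = solve-∀
    regroup₅ : ∀ D a x → D * (a * x) ≡ a * (D * x)
    regroup₅ = solve-∀
    regroup₆ : ∀ Q D x → Q * x + Q * x ≡ Q * (2 * x)
    regroup₆ = solve-∀
    regroup₇ : ∀ Q m → Q * m + Q * m ≡ 2 * (Q * m)
    regroup₇ = solve-∀

    invariant : ∀ k → Invariant k
    invariant zero = inj₁ (1≤m , z≤n)
    invariant (suc k) with invariant k
    ... | inj₂ (m<D^k , S≤) = inj₂ (≤-trans m<D^k D^k≤ , step)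
      where
      D^k≤ : D ^ k ≤ D * D ^ k
      D^k≤ = m≤n*m (D ^ k) D {{>-nonZero (≤-trans (s≤s z≤n) 2≤D)}}
      q = Q * (m * m)
      step : (Σ< k B + B k) * (D * D ^ k) + 2 * q ≤ 4 * (Q * m) * (D * D ^ k)
      step = begin
        (Σ< k B + B k) * (D * D ^ k) + 2 * q              ≡⟨ regroup₃ D (Σ< k B) (B k) (D ^ k) q ⟩
        -- Scaling by `D` turns the tail `2 * q` into `2 * (D * q)`: one half pays for the new term,
        -- and the other is at least the remaining tail because `2 ≤ D`.
        D * (Σ< k B * D ^ k) + D * (B k * D ^ k) + 2 * q  ≤⟨ +-mono-≤ (+-monoʳ-≤ _ (*-monoʳ-≤ D (BD≤ k))) (*-monoˡ-≤ q 2≤D) ⟩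
        D * (Σ< k B * D ^ k) + D * q + D * q              ≡⟨ regroup₄ D (Σ< k B * D ^ k) q ⟩
        D * (Σ< k B * D ^ k + 2 * q)                      ≤⟨ *-monoʳ-≤ D S≤ ⟩
        D * (4 * (Q * m) * D ^ k)                         ≡⟨ regroup₅ D (4 * (Q * m)) (D ^ k) ⟩
        4 * (Q * m) * (D * D ^ k)                         ∎
    ... | inj₁ (D^k≤m , S≤) with D ^ suc k ≤? m
    ...   | yes D^1+k≤m = inj₁ (D^1+k≤m , (begin
        Σ< k B + B k           ≤⟨ +-mono-≤ S≤ (B≤ k) ⟩
        Q * D ^ k + Q * D ^ k  ≡⟨ regroup₆ Q D (D ^ k) ⟩
        Q * (2 * D ^ k)        ≤⟨ *-monoʳ-≤ Q (*-monoˡ-≤ (D ^ k) 2≤D) ⟩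
        Q * D ^ suc k          ∎))
    -- The scale first exceeds `m` here: half of `4 * (Q * m)` pays for all terms so far and the
    -- other half for the tail, since `m < x`.
    ...   | no D^1+k≰m = inj₂ (m<x , (begin
        (Σ< k B + B k) * x + 2 * (Q * (m * m))       ≤⟨ +-mono-≤ (*-monoˡ-≤ x S≤2Qm) (≤-trans (≤-reflexive (regroup₂ Q m)) (*-monoʳ-≤ (2 * (Q * m)) (<⇒≤ m<x))) ⟩
        2 * (Q * m) * x + 2 * (Q * m) * x            ≡⟨ regroup₁ Q m x ⟩
        4 * (Q * m) * x                              ∎))
      where
      x = D ^ suc k
      m<x : m < x
      m<x = ≰⇒> D^1+k≰m
      S≤2Qm : Σ< k B + B k ≤ 2 * (Q * m)
      S≤2Qm = begin
        Σ< k B + B k           ≤⟨ +-mono-≤ S≤ (B≤ k) ⟩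
        Q * D ^ k + Q * D ^ k  ≤⟨ +-mono-≤ (*-monoʳ-≤ Q D^k≤m) (*-monoʳ-≤ Q D^k≤m) ⟩
        Q * m + Q * m          ≡⟨ regroup₇ Q m ⟩
        2 * (Q * m)            ∎

    conclude : ∀ k → Invariant k → Σ< k B ≤ 4 * (Q * m)
    conclude k (inj₁ (D^k≤m , S≤)) = begin
      Σ< k B       ≤⟨ S≤ ⟩
      Q * D ^ k    ≤⟨ *-monoʳ-≤ Q D^k≤m ⟩
      Q * m        ≤⟨ m≤n*m (Q * m) 4 ⟩
      4 * (Q * m)  ∎
    conclude k (inj₂ (m<D^k , S≤)) =
      *-cancelʳ-≤ (Σ< k B) (4 * (Q * m)) (D ^ k) {{>-nonZero (m<n⇒0<n m<D^k)}} (m+n≤o⇒m≤o (Σ< k B * D ^ k) S≤)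

  -- Counting multiples in an interval.

  -- This is 1 if d divides suc u and 0 otherwise.
  hit : (d : ℕ) .{{_ : NonZero d}} → ℕ → ℕ
  hit d u = suc u / d ∸ u / d

  u<[1+u/d]*d : ∀ u d .{{_ : NonZero d}} → u < suc (u / d) * d
  u<[1+u/d]*d u d = begin-strict
    u                  ≡⟨ m≡m%n+[m/n]*n u d ⟩
    u % d + u / d * d  <⟨ +-monoˡ-< (u / d * d) (m%n<n u d) ⟩
    d + u / d * d      ∎
    where open ≤-Reasoning

  ∣⇒hit : ∀ {d u} .{{_ : NonZero d}} → d ∣ suc u → 1 ≤ hit d u
  ∣⇒hit {d} {u} d∣1+u = m<n⇒0<n∸m (m<n*o⇒m/o<n {o = d} (≤-reflexive (sym (m/n*n≡m d∣1+u))))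

  -- Telescoping: each `hit` is a difference of successive quotients, and quotients are monotone, so
  -- truncated subtraction loses nothing.
  Σ<-hit : ∀ d .{{_ : NonZero d}} u n → Σ< n (λ i → hit d (u + i)) ≡ (u + n) / d ∸ u / d
  Σ<-hit d u zero    = sym (trans (cong (λ v → v / d ∸ u / d) (+-identityʳ u)) (n∸n≡0 (u / d)))
  Σ<-hit d u (suc n) = begin
    Σ< n (λ i → hit d (u + i)) + hit d (u + n)                      ≡⟨ cong (_+ hit d (u + n)) (Σ<-hit d u n) ⟩
    (u + n) / d ∸ u / d + (suc (u + n) / d ∸ (u + n) / d)           ≡⟨ +-comm ((u + n) / d ∸ u / d) _ ⟩
    suc (u + n) / d ∸ (u + n) / d + ((u + n) / d ∸ u / d)           ≡⟨ +-∸-assoc (suc (u + n) / d ∸ (u + n) / d) (/-monoˡ-≤ d (m≤m+n u n)) ⟨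
    suc (u + n) / d ∸ (u + n) / d + (u + n) / d ∸ u / d             ≡⟨ cong (_∸ u / d) (m∸n+n≡m (/-monoˡ-≤ d (n≤1+n (u + n)))) ⟩
    suc (u + n) / d ∸ u / d                                         ≡⟨ cong (λ v → v / d ∸ u / d) (+-suc u n) ⟨
    (u + suc n) / d ∸ u / d                                         ∎
    where open ≡-Reasoning

  -- The floors in the telescoped sum account for at most one extra multiple, that is, one extra `d`
  -- after clearing the denominator.
  Σ<-hit-≤ : ∀ d .{{_ : NonZero d}} u n → Σ< n (λ i → hit d (u + i)) * d ≤ n + d
  Σ<-hit-≤ d u n = begin
    Σ< n (λ i → hit d (u + i)) * d     ≡⟨ cong (_* d) (Σ<-hit d u n) ⟩
    ((u + n) / d ∸ u / d) * d          ≡⟨ *-distribʳ-∸ d ((u + n) / d) (u / d) ⟩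
    (u + n) / d * d ∸ u / d * d        ≤⟨ ∸-monoˡ-≤ (u / d * d) (m/n*n≤m (u + n) d) ⟩
    u + n ∸ u / d * d                  ≤⟨ ∸-monoˡ-≤ (u / d * d) (+-monoˡ-≤ n (<⇒≤ (u<[1+u/d]*d u d))) ⟩
    d + u / d * d + n ∸ u / d * d      ≡⟨ cong (_∸ u / d * d) (regroup d (u / d * d) n) ⟩
    n + d + u / d * d ∸ u / d * d      ≡⟨ m+n∸n≡m (n + d) (u / d * d) ⟩
    n + d                              ∎
    where
    open ≤-Reasoning
    regroup : ∀ a b c → a + b + c ≡ c + a + b
    regroup = solve-∀

  f≤Σ< : ∀ (f : ℕ → ℕ) {i n} → i < n → f i ≤ Σ< n f
  f≤Σ< f {i} i<n = ≤-trans (m≤n+m (f i) (Σ< i f)) (Σ<-monoʳ-≤ f i<n)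

  -- Cost of one rounded job, summed over segments and parts.

  below : ℕ → ℕ → ℕ
  below m e = if does (e <? m) then e else 0

  below-< : ∀ {m e} → e < m → below m e ≡ e
  below-< {m} {e} e<m rewrite dec-true (e <? m) e<m = refl

  below-≥ : ∀ {m e} → m ≤ e → below m e ≡ 0
  below-≥ {m} {e} m≤e rewrite dec-false (e <? m) (≤⇒≯ m≤e) = refl

  below-≤ : ∀ m e → below m e ≤ e
  below-≤ m e with e <? m
  ... | yes e<m = ≤-reflexive (below-< e<m)
  ... | no  e≮m = ≤-trans (≤-reflexive (below-≥ (≮⇒≥ e≮m))) z≤n

  -- The leftmost segment of a part is charged from the release time, hence the extra `e` at index
  -- 0.
  pieceLen : ℕ → ℕ → ℕ → ℕ
  pieceLen e s zero    = e + s
  pieceLen e s (suc i) = s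

  -- The cost, for unit weight, of the i-th segment of a part that starts e after the
  -- release time and has segments of length s, if the job is run for m time units.
  piece : ℕ → ℕ → ℕ → ℕ → ℕ
  piece e s m i = if does (e + i * s <? m) then pieceLen e s i else 0

  piece-< : ∀ {e s m} i → e + i * s < m → piece e s m i ≡ pieceLen e s i
  piece-< {e} {s} {m} i lt rewrite dec-true (e + i * s <? m) lt = refl

  piece-≥ : ∀ {e s m} i → m ≤ e + i * s → piece e s m i ≡ 0
  piece-≥ {e} {s} {m} i ge rewrite dec-false (e + i * s <? m) (≤⇒≯ ge) = refl

  Σ<-pieceLen : ∀ e s k → Σ< k (pieceLen e s) ≤ e + k * s
  Σ<-pieceLen e s zero          = z≤n
  Σ<-pieceLen e s (suc zero)    = ≤-reflexive (cong (e +_) (sym (+-identityʳ s)))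
  Σ<-pieceLen e s (suc (suc k)) = begin
    Σ< (suc k) (pieceLen e s) + s  ≤⟨ +-monoˡ-≤ s (Σ<-pieceLen e s (suc k)) ⟩
    e + suc k * s + s              ≡⟨ regroup e (suc k * s) s ⟩
    e + suc (suc k) * s            ∎
    where
    open ≤-Reasoning
    regroup : ∀ a b c → a + b + c ≡ a + (c + b)
    regroup = solve-∀

  piece≤pieceLen : ∀ e s m i → piece e s m i ≤ pieceLen e s i
  piece≤pieceLen e s m i with e + i * s <? m
  ... | yes lt = ≤-reflexive (piece-< i lt)
  ... | no ¬lt = ≤-trans (≤-reflexive (piece-≥ i (≮⇒≥ ¬lt))) z≤n

  Σ<-piece≤end : ∀ e s m k → Σ< k (piece e s m) ≤ e + k * s
  Σ<-piece≤end e s m k =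
    ≤-trans (Σ<-mono k (λ i _ → piece≤pieceLen e s m i)) (Σ<-pieceLen e s k)

  -- The last segment taken begins at `m - 1` or earlier and so ends by `m + s - 1`. The `∸ 1`
  -- matters: unit segments then have no rounding error, as is required for the first part, which
  -- begins at distance 0.
  Σ<-piece≤m+s : ∀ e s m k → Σ< k (piece e s m) ≤ m + (s ∸ 1)
  Σ<-piece≤m+s e s m zero    = z≤n
  Σ<-piece≤m+s e s m (suc k) with e + k * s <? m
  ... | no ¬lt = ≤-trans (≤-reflexive (trans (cong (Σ< k (piece e s m) +_) (piece-≥ k (≮⇒≥ ¬lt))) (+-identityʳ _)))
                         (Σ<-piece≤m+s e s m k)
  ... | yes lt = begin
    Σ< (suc k) (piece e s m)  ≤⟨ Σ<-piece≤end e s m (suc k) ⟩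
    e + (s + k * s)           ≡⟨ regroup e s (k * s) ⟩
    e + k * s + s             ≤⟨ +-monoʳ-≤ (e + k * s) (m≤n+m∸n s 1) ⟩
    e + k * s + suc (s ∸ 1)   ≡⟨ +-suc (e + k * s) (s ∸ 1) ⟩
    suc (e + k * s) + (s ∸ 1) ≤⟨ +-monoˡ-≤ (s ∸ 1) lt ⟩
    m + (s ∸ 1)               ∎
    where
    open ≤-Reasoning
    regroup : ∀ a b c → a + (b + c) ≡ a + c + b
    regroup = solve-∀

  Σ<-piece-≥ : ∀ {e} s {m} k → m ≤ e → Σ< k (piece e s m) ≡ 0
  Σ<-piece-≥ {e} s {m} k m≤e =
    trans (Σ<-cong k (λ i _ → piece-≥ i (≤-trans m≤e (m≤m+n e (i * s)))))
          (trans (Σ<-const k 0) (*-zeroʳ k))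

  -- The part in which the job completes costs at most m plus the rounding error,
  -- which is charged to the start of that part; every earlier part costs its end.
  Σ<-parts-≤ : ∀ m l (e s k : ℕ → ℕ) → e 0 ≡ 0 → (∀ h → e h + k h * s h ≡ e (suc h)) →
    (∀ h → s h ∸ 1 ≤ e h) → m ≤ e (suc l) →
    Σ< (suc l) (λ h → Σ< (k h) (piece (e h) (s h) m)) ≤ m + 2 * Σ< l (λ h → below m (e (suc h)))
  Σ<-parts-≤ m l e s k e0≡0 e-step s≤e m≤el = begin
    Σ< (suc l) part                                        ≤⟨ invariant (suc l) ⟩
    -- `m ≤ e (suc l)` kills the last term of the first sum and `e 0 ≡ 0` the first term of the
    -- second, so both become the same sum.
    Σ< (suc l) g′ + Σ< (suc l) g + done (suc l)      ≡⟨ cong₂ _+_ (cong₂ _+_ (cong (Σ< l g′ +_) (below-≥ m≤el)) first) (done-≥ m≤el) ⟩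
    Σ< l g′ + 0 + Σ< l g′ + m                  ≡⟨ regroup (Σ< l g′) m ⟩
    m + 2 * Σ< l g′                                  ∎
    where
    open ≤-Reasoning
    regroup : ∀ a m → a + 0 + a + m ≡ m + 2 * a
    regroup = solve-∀
    part g g′ done : ℕ → ℕ
    part h = Σ< (k h) (piece (e h) (s h) m)
    g h = below m (e h)
    g′ h = g (suc h)
    -- A potential that jumps from 0 to `m` when the job completes, so that `m` is paid only once
    -- over all parts.
    done h = if does (m ≤? e h) then m else 0
    done-≥ : ∀ {h} → m ≤ e h → done h ≡ m
    done-≥ {h} m≤eh rewrite dec-true (m ≤? e h) m≤eh = refl
    done-< : ∀ {h} → e h < m → done h ≡ 0
    done-< {h} eh<m rewrite dec-false (m ≤? e h) (<⇒≱ eh<m) = refl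
    e-mono : ∀ h → e h ≤ e (suc h)
    e-mono h = ≤-trans (m≤m+n (e h) (k h * s h)) (≤-reflexive (e-step h))
    first : Σ< (suc l) g ≡ Σ< l g′
    first = trans (Σ<-+ 1 l g) (cong (_+ Σ< l g′) (trans (cong (below m) e0≡0) below0))
      where
      below0 : below m 0 ≡ 0
      below0 with 0 <? m
      ... | yes lt = below-< lt
      ... | no ¬lt = below-≥ (≮⇒≥ ¬lt)
    step : ∀ h → done h + part h ≤ g (suc h) + g h + done (suc h)
    step h with e h <? m | e (suc h) <? m
    ... | no e≮m | _ = begin
      done h + part h                ≡⟨ cong₂ _+_ (done-≥ (≮⇒≥ e≮m)) (Σ<-piece-≥ (s h) (k h) (≮⇒≥ e≮m)) ⟩
      m + 0                          ≡⟨ +-identityʳ m ⟩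
      m                              ≡⟨ done-≥ (≤-trans (≮⇒≥ e≮m) (e-mono h)) ⟨
      done (suc h)                   ≤⟨ m≤n+m (done (suc h)) (g (suc h) + g h) ⟩
      g (suc h) + g h + done (suc h) ∎
    ... | yes e<m | yes e′<m = begin
      done h + part h                ≡⟨ cong (_+ part h) (done-< e<m) ⟩
      part h                         ≤⟨ Σ<-piece≤end (e h) (s h) m (k h) ⟩
      e h + k h * s h                ≡⟨ e-step h ⟩
      e (suc h)                      ≡⟨ below-< e′<m ⟨
      g (suc h)                      ≤⟨ m≤m+n _ _ ⟩
      g (suc h) + g h                ≤⟨ m≤m+n _ _ ⟩
      g (suc h) + g h + done (suc h) ∎
    ... | yes e<m | no e′≮m = begin
      done h + part h                ≡⟨ cong (_+ part h) (done-< e<m) ⟩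
      part h                         ≤⟨ Σ<-piece≤m+s (e h) (s h) m (k h) ⟩
      m + (s h ∸ 1)                  ≤⟨ +-monoʳ-≤ m (s≤e h) ⟩
      m + e h                        ≡⟨ +-comm m (e h) ⟩
      e h + m                        ≡⟨ cong₂ _+_ (below-< e<m) (done-≥ (≮⇒≥ e′≮m)) ⟨
      g h + done (suc h)             ≤⟨ +-monoˡ-≤ (done (suc h)) (m≤n+m (g h) (g (suc h))) ⟩
      g (suc h) + g h + done (suc h) ∎
    invariant : ∀ h → Σ< h part ≤ Σ< h g′ + Σ< h g + done h
    invariant zero    = z≤n
    invariant (suc h) = begin
      Σ< h part + part h                                        ≤⟨ +-monoˡ-≤ (part h) (invariant h) ⟩
      Σ< h g′ + Σ< h g + done h + part h                  ≡⟨ +-assoc (Σ< h g′ + Σ< h g) (done h) (part h) ⟩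
      Σ< h g′ + Σ< h g + (done h + part h)                ≤⟨ +-monoʳ-≤ (Σ< h g′ + Σ< h g) (step h) ⟩
      Σ< h g′ + Σ< h g + (g (suc h) + g h + done (suc h)) ≡⟨ +-assoc (Σ< h g′ + Σ< h g) (g (suc h) + g h) (done (suc h)) ⟨
      Σ< h g′ + Σ< h g + (g (suc h) + g h) + done (suc h) ≡⟨ cong (_+ done (suc h)) (interchange (Σ< h g′) (Σ< h g) (g (suc h)) (g h)) ⟩
      Σ< (suc h) g′ + Σ< (suc h) g + done (suc h)         ∎
      where
      interchange : ∀ a b c d → a + b + (c + d) ≡ a + c + (b + d)
      interchange = solve-∀

  -- Ends of the chain of cells that starts at a given point.

  module Endpoints (L : ℕ → ℕ) (L≢0 : ∀ h → NonZero (L h)) where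

    -- The distance from q to the right end of the cell of height h ∸ 1 in the chain
    -- of cells that starts at q, if the cells of height h are the [i L h , (i+1) L h).
    endDist : ℕ → ℕ → ℕ
    endDist q zero    = 0
    endDist q (suc h) = suc ((q + endDist q h) / L h) * L h ∸ q
      where instance _ = L≢0 h

    module _ (q : ℕ) where

      end≡ : ∀ h → q + endDist q (suc h) ≡ suc (_/_ (q + endDist q h) (L h) {{L≢0 h}}) * L h
      end≡ h = m+[n∸m]≡n (≤-trans (m≤m+n q (endDist q h)) (<⇒≤ (u<[1+u/d]*d (q + endDist q h) (L h))))
        where instance _ = L≢0 h

      endDist-< : ∀ h → endDist q h < endDist q (suc h)
      endDist-< h = +-cancelˡ-< q _ _
        (<-≤-trans (u<[1+u/d]*d (q + endDist q h) (L h)) (≤-reflexive (sym (end≡ h))))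
        where instance _ = L≢0 h

      endDist-≤-+ : ∀ h → endDist q (suc h) ≤ endDist q h + L h
      endDist-≤-+ h = +-cancelˡ-≤ q _ _ (begin
        q + endDist q (suc h)           ≡⟨ end≡ h ⟩
        L h + (q + endDist q h) / L h * L h ≤⟨ +-monoʳ-≤ (L h) (m/n*n≤m (q + endDist q h) (L h)) ⟩
        L h + (q + endDist q h)         ≡⟨ regroup (L h) q (endDist q h) ⟩
        q + (endDist q h + L h)         ∎)
        where
        instance _ = L≢0 h
        open ≤-Reasoning
        regroup : ∀ a b c → a + (b + c) ≡ b + (c + a)
        regroup = solve-∀

      ∣-end : ∀ h → L h ∣ q + endDist q (suc h)
      ∣-end h = divides (suc (_/_ (q + endDist q h) (L h) {{L≢0 h}})) (end≡ h)

      L≤end : ∀ h → L h ≤ q + endDist q (suc h)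
      L≤end h = ≤-trans (m≤m+n (L h) _) (≤-reflexive (sym (end≡ h)))

      module _ (L∣L : ∀ h → L h ∣ L (suc h)) where

        -- The two ends are multiples of `L (suc h)` and of `L h`, hence of `d`, and the starting
        -- point `q` cancels in the difference.
        ∣-gap : ∀ h {d} → d ∣ L h → d ∣ endDist q (2 + h) ∸ endDist q (1 + h)
        ∣-gap h {d} d∣L = subst (d ∣_) ([m+n]∸[m+o]≡n∸o q (endDist q (2 + h)) (endDist q (1 + h)))
          (∣m∣n⇒∣m∸n (∣-trans d∣L (∣-trans (L∣L h) (∣-end (suc h)))) (∣-trans d∣L (∣-end h)))
          where
          ∣m∣n⇒∣m∸n : ∀ {d m n} → d ∣ m → d ∣ n → d ∣ m ∸ n
          ∣m∣n⇒∣m∸n {d} (divides x refl) (divides y refl) = divides (x ∸ y) (sym (*-distribʳ-∸ d x y))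

        -- The gap between two successive ends is a positive multiple of `L h`. This bounds the
        -- segment length used two heights up by the distance at which that part begins.
        L≤endDist : ∀ h → L h ≤ endDist q (2 + h)
        L≤endDist h = ≤-trans (∣⇒≤ {{>-nonZero (m<n⇒0<n∸m (endDist-< (suc h)))}} (∣-gap h ∣-refl))
                              (m∸n≤m (endDist q (2 + h)) (endDist q (1 + h)))

      module _ (2L≤L : ∀ h → 2 * L h ≤ L (suc h)) where

        -- Mutual induction: one more end adds at most `L h`, and the distance accumulated before is
        -- at most `L h` as well, because cell lengths at least double.
        endDist≤2L : ∀ h → endDist q (suc h) ≤ 2 * L h
        endDist≤L  : ∀ h → endDist q h ≤ L h
        endDist≤2L h = begin
          endDist q (suc h)  ≤⟨ endDist-≤-+ h ⟩
          endDist q h + L h  ≤⟨ +-monoˡ-≤ (L h) (endDist≤L h) ⟩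
          L h + L h          ≡⟨ cong (L h +_) (+-identityʳ (L h)) ⟨
          2 * L h            ∎
          where open ≤-Reasoning
        endDist≤L zero    = z≤n
        endDist≤L (suc h) = ≤-trans (endDist≤2L h) (2L≤L h)

    -- If the end is closer than m then one of the next m points is a multiple of L h.
    below-endDist-≤ : ∀ m q h → below m (endDist q (suc h)) ≤ m * Σ< m (λ d → hit (L h) {{L≢0 h}} (q + d))
    below-endDist-≤ m q h with endDist q (suc h) <? m
    ... | no ≮m = ≤-trans (≤-reflexive (below-≥ (≮⇒≥ ≮m))) z≤n
    ... | yes <m with endDist q (suc h) | ∣-end q h
    ...   | zero  | _ = ≤-trans (below-≤ m 0) z≤n
    ...   | suc d | L∣end = begin
      below m (suc d)  ≡⟨ below-< <m ⟩
      suc d            ≤⟨ <⇒≤ <m ⟩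
      m                ≡⟨ *-identityʳ m ⟨
      m * 1            ≤⟨ *-monoʳ-≤ m (≤-trans (∣⇒hit (subst (L h ∣_) (+-suc q d) L∣end)) (f≤Σ< (λ d → hit (L h) (q + d)) (<⇒≤ <m))) ⟩
      m * Σ< m (λ d → hit (L h) (q + d)) ∎
      where
      instance _ = L≢0 h
      open ≤-Reasoning

    -- Double counting: for each of the `m` shifts `d`, at most `R / L h + 1` of the `R` grid
    -- positions `a` produce a multiple. The other factor `m` bounds the distance itself, which
    -- gives the bound of order `m * m / L h` on average, with denominators cleared.
    Σ<-below-endDist-≤ : ∀ m r h R →
      Σ< R (λ a → below m (endDist (r + a) (suc h))) * L h ≤ m * (m * (R + L h))
    Σ<-below-endDist-≤ m r h R = begin
      Σ< R (λ a → below m (endDist (r + a) (suc h))) * L h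
        ≤⟨ *-monoˡ-≤ (L h) (Σ<-mono R (λ a _ → below-endDist-≤ m (r + a) h)) ⟩
      Σ< R (λ a → m * Σ< m (λ d → hit (L h) (r + a + d))) * L h
        ≡⟨ cong (_* L h) (Σ<-distrib-* R m _) ⟩
      m * Σ< R (λ a → Σ< m (λ d → hit (L h) (r + a + d))) * L h
        ≡⟨ cong (λ x → m * x * L h) (Σ<-comm R m _) ⟩
      m * Σ< m (λ d → Σ< R (λ a → hit (L h) (r + a + d))) * L h
        ≡⟨ regroup m _ (L h) ⟩
      m * (L h * Σ< m (λ d → Σ< R (λ a → hit (L h) (r + a + d))))
        ≡⟨ cong (m *_) (Σ<-distrib-* m (L h) _) ⟨
      m * Σ< m (λ d → L h * Σ< R (λ a → hit (L h) (r + a + d)))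
        ≤⟨ *-monoʳ-≤ m (Σ<-≤-* m (R + L h) (λ d _ → column d)) ⟩
      m * (m * (R + L h)) ∎
      where
      instance _ = L≢0 h
      open ≤-Reasoning
      regroup : ∀ a b c → a * b * c ≡ a * (c * b)
      regroup = solve-∀
      swap : ∀ a b c → a + b + c ≡ a + c + b
      swap = solve-∀
      column : ∀ d → L h * Σ< R (λ a → hit (L h) (r + a + d)) ≤ R + L h
      column d = begin
        L h * Σ< R (λ a → hit (L h) (r + a + d))  ≡⟨ *-comm (L h) _ ⟩
        Σ< R (λ a → hit (L h) (r + a + d)) * L h  ≡⟨ cong (_* L h) (Σ<-cong R (λ a _ → cong (λ u → hit (L h) u) (swap r a d))) ⟩
        Σ< R (λ a → hit (L h) (r + d + a)) * L h  ≤⟨ Σ<-hit-≤ (L h) (r + d) R ⟩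
        R + L h                                   ∎

  -- Summation over all offsets and heights.

  2≤[2n]^n : ∀ n .{{_ : NonZero n}} → 2 ≤ (2 * n) ^ n
  2≤[2n]^n n = begin
    2            ≤⟨ m≤m*n 2 n ⟩
    2 * n        ≡⟨ *-identityʳ (2 * n) ⟨
    (2 * n) ^ 1  ≤⟨ ^-monoʳ-≤ (2 * n) {{m*n≢0 2 n}} (>-nonZero⁻¹ n) ⟩
    (2 * n) ^ n  ∎
    where open ≤-Reasoning

  -- After exchanging the sums, the cell lengths D^b K^h are exactly the powers of D
  -- below D^(N l) = K^l =: R together with the N powers of height l. The former
  -- contribute a two-sided geometric sum around m, the latter are at least R ≥ K T.
  Σ<-below-endDist-grid : ∀ N → 2 ≤ N → ∀ T l → 1 ≤ T → T * (2 * N) ^ N ≤ ((2 * N) ^ N) ^ l →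
    (L≢0 : ∀ b h → NonZero ((2 * N) ^ b * ((2 * N) ^ N) ^ h)) →
    ∀ r m → 1 ≤ m → r + m ≤ suc T →
    Σ< (((2 * N) ^ N) ^ l) (λ a → Σ< N λ b → Σ< (suc l) λ h →
      below m (Endpoints.endDist (λ h → (2 * N) ^ b * ((2 * N) ^ N) ^ h) (L≢0 b) (r + a) (suc h)))
    ≤ 12 * (((2 * N) ^ N) ^ l * m)
  Σ<-below-endDist-grid N 2≤N T l 1≤T TK≤R L≢0 r m 1≤m r+m≤ = begin
    Σ< R (λ a → Σ< N λ b → Σ< (suc l) λ h → g a b h)
      ≡⟨ Σ<-comm R N _ ⟩
    Σ< N (λ b → Σ< R λ a → Σ< (suc l) λ h → g a b h)
      ≡⟨ Σ<-cong N (λ b _ → Σ<-comm R (suc l) _) ⟩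
    Σ< N (λ b → Σ< (suc l) λ h → X h b)
      ≡⟨ Σ<-comm N (suc l) _ ⟩
    Σ< l (λ h → Σ< N λ b → X h b) + Σ< N (X l)
      ≤⟨ +-mono-≤ (Σ<-mono l (λ h h<l → Σ<-mono N (λ b b<N → X≤β h b h<l b<N))) top ⟩
    Σ< l (λ h → Σ< N λ b → β (h * N + b)) + 4 * (R * m)
      ≡⟨ cong (_+ 4 * (R * m)) (Σ<-* l N β) ⟨
    Σ< (l * N) β + 4 * (R * m)
      ≤⟨ +-monoˡ-≤ (4 * (R * m)) (Σ<-two-sided-geometric D 2≤D (2 * R) m 1≤m β β≤ βD≤ (l * N)) ⟩
    -- The geometric sum with `Q = 2 * R` contributes `4 * 2` and the top height another `4`,
    -- together `12`.
    4 * (2 * R * m) + 4 * (R * m)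
      ≡⟨ regroup R m ⟩
    12 * (R * m) ∎
    where
    open ≤-Reasoning
    D K R : ℕ
    D = 2 * N
    K = D ^ N
    R = K ^ l
    N≤D : N ≤ D
    N≤D = m≤n*m N 2
    2≤D : 2 ≤ D
    2≤D = ≤-trans 2≤N N≤D
    instance
      D≢0 : NonZero D
      D≢0 = >-nonZero (<⇒≤ 2≤D)
    D^≢0 : ∀ k → NonZero (D ^ k)
    D^≢0 k = m^n≢0 D k
    regroup : ∀ R m → 4 * (2 * R * m) + 4 * (R * m) ≡ 12 * (R * m)
    regroup = solve-∀
    L : ℕ → ℕ → ℕ
    L b h = D ^ b * K ^ h
    g : ℕ → ℕ → ℕ → ℕ
    g a b h = below m (Endpoints.endDist (L b) (L≢0 b) (r + a) (suc h))
    X : ℕ → ℕ → ℕ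
    X h b = Σ< R λ a → g a b h
    -- The geometric sum lemma asks for its bounds at every `k`, but the second bound on `X` is
    -- established only below height `l`. Hence `X` is replaced by the minimum of its two bounds.
    β : ℕ → ℕ
    β k = (2 * R * D ^ k) ⊓ _/_ (2 * R * (m * m)) (D ^ k) {{D^≢0 k}}
    β≤ : ∀ k → β k ≤ 2 * R * D ^ k
    β≤ k = m⊓n≤m _ _
    βD≤ : ∀ k → β k * D ^ k ≤ 2 * R * (m * m)
    βD≤ k = ≤-trans (*-monoˡ-≤ (D ^ k) (m⊓n≤n (2 * R * D ^ k) _)) (m/n*n≤m (2 * R * (m * m)) (D ^ k) {{D^≢0 k}})
    L≡ : ∀ b h → L b h ≡ D ^ (h * N + b)
    L≡ b h = begin-equality
      D ^ b * (D ^ N) ^ h  ≡⟨ cong (D ^ b *_) (^-*-assoc D N h) ⟩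
      D ^ b * D ^ (N * h)  ≡⟨ ^-distribˡ-+-* D b (N * h) ⟨
      D ^ (b + N * h)      ≡⟨ cong (D ^_) (trans (+-comm b (N * h)) (cong (_+ b) (*-comm N h))) ⟩
      D ^ (h * N + b)      ∎
    R≡ : D ^ (l * N) ≡ R
    R≡ = trans (cong (D ^_) (*-comm l N)) (sym (^-*-assoc D N l))
    1≤N : 1 ≤ N
    1≤N = <⇒≤ 2≤N
    D≤K : D ≤ K
    D≤K = ≤-trans (≤-reflexive (sym (*-identityʳ D))) (^-monoʳ-≤ D 1≤N)
    2L≤L : ∀ b h → 2 * L b h ≤ L b (suc h)
    2L≤L b h = begin
      2 * (D ^ b * K ^ h)  ≤⟨ *-monoˡ-≤ (D ^ b * K ^ h) (≤-trans 2≤D D≤K) ⟩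
      K * (D ^ b * K ^ h)  ≡⟨ swap K (D ^ b) (K ^ h) ⟩
      D ^ b * (K * K ^ h)  ∎
      where
      swap : ∀ x y z → x * (y * z) ≡ y * (x * z)
      swap = solve-∀
    X≤β : ∀ h b → h < l → b < N → X h b ≤ β (h * N + b)
    X≤β h b h<l b<N = ⊓-glb size-bound (≤-trans (≤-reflexive (sym (m*n/n≡m (X h b) (D ^ k)))) (/-monoˡ-≤ (D ^ k) hit-bound))
      where
      k = h * N + b
      instance _ = D^≢0 k
      D^k≤R : D ^ k ≤ R
      D^k≤R = begin
        D ^ k        ≤⟨ ^-monoʳ-≤ D (≤-trans (+-monoʳ-≤ (h * N) (<⇒≤ b<N)) (≤-trans (≤-reflexive (+-comm (h * N) N)) (*-monoˡ-≤ N h<l))) ⟩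
        D ^ (l * N)  ≡⟨ R≡ ⟩
        R            ∎
      size-bound : X h b ≤ 2 * R * D ^ k
      size-bound = begin
        X h b              ≤⟨ Σ<-≤-* R (2 * L b h) (λ a _ → ≤-trans (below-≤ m _) (Endpoints.endDist≤2L (L b) (L≢0 b) (r + a) (2L≤L b) h)) ⟩
        R * (2 * L b h)    ≡⟨ cong (λ x → R * (2 * x)) (L≡ b h) ⟩
        R * (2 * D ^ k)    ≡⟨ shift R (D ^ k) ⟩
        2 * R * D ^ k      ∎
        where
        shift : ∀ x y → x * (2 * y) ≡ 2 * x * y
        shift = solve-∀
      hit-bound : X h b * D ^ k ≤ 2 * R * (m * m)
      hit-bound = begin
        X h b * D ^ k          ≡⟨ cong (X h b *_) (L≡ b h) ⟨
        X h b * L b h          ≤⟨ Endpoints.Σ<-below-endDist-≤ (L b) (L≢0 b) m r h R ⟩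
        m * (m * (R + L b h))  ≡⟨ cong (λ x → m * (m * (R + x))) (L≡ b h) ⟩
        m * (m * (R + D ^ k))  ≤⟨ *-monoʳ-≤ m (*-monoʳ-≤ m (+-monoʳ-≤ R D^k≤R)) ⟩
        m * (m * (R + R))      ≡⟨ shift m R ⟩
        2 * R * (m * m)        ∎
        where
        shift : ∀ x y → x * (x * (y + y)) ≡ 2 * y * (x * x)
        shift = solve-∀
    m≤2T : m ≤ 2 * T
    m≤2T = begin
      m            ≤⟨ m+n≤o⇒n≤o r r+m≤ ⟩
      1 + T        ≤⟨ +-monoˡ-≤ T 1≤T ⟩
      T + T        ≡⟨ cong (T +_) (+-identityʳ T) ⟨
      2 * T        ∎
    -- At height `l` the cells have length at least `R`, so `R + L b l` is at most `2 * L b l` and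
    -- the length cancels.
    Xl≤ : ∀ b → X l b ≤ 2 * (m * m)
    Xl≤ b = *-cancelʳ-≤ (X l b) (2 * (m * m)) (L b l) {{L≢0 b l}} (begin
      X l b * L b l              ≤⟨ Endpoints.Σ<-below-endDist-≤ (L b) (L≢0 b) m r l R ⟩
      m * (m * (R + L b l))      ≤⟨ *-monoʳ-≤ m (*-monoʳ-≤ m (+-monoˡ-≤ (L b l) (m≤n*m R (D ^ b) {{D^≢0 b}}))) ⟩
      m * (m * (L b l + L b l))  ≡⟨ shift m (L b l) ⟩
      2 * (m * m) * L b l        ∎)
      where
      shift : ∀ x y → x * (x * (y + y)) ≡ 2 * (x * x) * y
      shift = solve-∀
    top : Σ< N (X l) ≤ 4 * (R * m)
    top = begin
      Σ< N (X l)             ≤⟨ Σ<-≤-* N (2 * (m * m)) (λ b _ → Xl≤ b) ⟩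
      -- One factor `m` is traded for `2 * T`; then `T * N ≤ T * K ≤ R` absorbs the number `N` of
      -- summands.
      N * (2 * (m * m))      ≤⟨ *-monoʳ-≤ N (*-monoʳ-≤ 2 (*-monoˡ-≤ m m≤2T)) ⟩
      N * (2 * (2 * T * m))  ≡⟨ shift N T m ⟩
      4 * (T * N * m)        ≤⟨ *-monoʳ-≤ 4 (*-monoˡ-≤ m (≤-trans (*-monoʳ-≤ T (≤-trans N≤D D≤K)) TK≤R)) ⟩
      4 * (R * m)            ∎
      where
      shift : ∀ x y z → x * (2 * (2 * y * z)) ≡ 4 * (y * x * z)
      shift = solve-∀

open import Defs
open import Data.Bool.Base using (Bool)
open import Data.Fin.Base using (Fin)
open import Data.Integer.Base using (ℤ; +_)
import Data.Nat.Base as ℕ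
open import Data.Nat.Base using (ℕ; NonTrivial)

-- Integer sums over lists and their translation to natural numbers.

module IntegerSums where

  open import Data.Bool.Base using (if_then_else_)
  open import Data.Fin.Base using (Fin; zero; suc; toℕ)
  open import Data.Integer.Base hiding (suc)
  open import Data.Integer.Properties
  open import Data.List.Base using (List; []; _∷_; _++_; map; filter; applyUpTo; tabulate; cartesianProduct)
  open import Data.List.Membership.Propositional using (_∈_)
  open import Data.List.Relation.Unary.Any using (here; there)
  open import Data.Product.Base using (_×_; _,_)
  open import Relation.Binary.PropositionalEquality hiding (J)
  open import Relation.Nullary.Decidable using (does; yes; no)
  open import Relation.Unary using (Decidable)
  open import Algebra.Properties.CommutativeSemigroup +-commutativeSemigroup using (interchange)
  open Arithmetic using (Σ<; Σ<-+)

  ∑-mono : {A : Set} (xs : List A) {f g : A → ℤ} → (∀ {x} → x ∈ xs → f x ≤ g x) → ∑ xs f ≤ ∑ xs g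
  ∑-mono []       f≤g = ≤-refl
  ∑-mono (x ∷ xs) f≤g = +-mono-≤ (f≤g (here refl)) (∑-mono xs (λ x∈xs → f≤g (there x∈xs)))

  ∑-cong : {A : Set} (xs : List A) {f g : A → ℤ} → (∀ x → f x ≡ g x) → ∑ xs f ≡ ∑ xs g
  ∑-cong []       f≡g = refl
  ∑-cong (x ∷ xs) f≡g = cong₂ _+_ (f≡g x) (∑-cong xs f≡g)

  ∑-strict-mono : {A : Set} {xs : List A} {f g : A → ℤ} → (∀ x → f x ≤ g x) →
    ∀ {x} → x ∈ xs → f x < g x → ∑ xs f < ∑ xs g
  ∑-strict-mono {xs = x ∷ xs} f≤g (here refl)  fx<gx = +-mono-<-≤ fx<gx (∑-mono xs (λ {y} _ → f≤g y))
  ∑-strict-mono {xs = x ∷ xs} f≤g (there x∈xs) fx<gx = +-mono-≤-< (f≤g x) (∑-strict-mono f≤g x∈xs fx<gx)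

  0≤∑ : {A : Set} (xs : List A) {f : A → ℤ} → (∀ x → 0ℤ ≤ f x) → 0ℤ ≤ ∑ xs f
  0≤∑ []       0≤f = ≤-refl
  0≤∑ (x ∷ xs) 0≤f = +-mono-≤ (0≤f x) (0≤∑ xs 0≤f)

  term≤∑ : {A : Set} {xs : List A} {f : A → ℤ} → (∀ x → 0ℤ ≤ f x) → ∀ {x} → x ∈ xs → f x ≤ ∑ xs f
  term≤∑ {xs = x ∷ xs} {f} 0≤f (here refl) =
    ≤-trans (≤-reflexive (sym (+-identityʳ (f x)))) (+-monoʳ-≤ (f x) (0≤∑ xs 0≤f))
  term≤∑ {xs = x ∷ xs} {f} 0≤f {y} (there y∈xs) =
    ≤-trans (≤-reflexive (sym (+-identityˡ (f y)))) (+-mono-≤ (0≤f x) (term≤∑ 0≤f y∈xs))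

  ∑-filter : {A : Set} {P : A → Set} (P? : Decidable P) (xs : List A) (f : A → ℤ) →
    ∑ (filter P? xs) f ≡ ∑ xs (λ x → if does (P? x) then f x else 0ℤ)
  ∑-filter P? []       f = refl
  ∑-filter P? (x ∷ xs) f with P? x
  ... | yes _ = cong (_+_ (f x)) (∑-filter P? xs f)
  ... | no  _ = trans (∑-filter P? xs f) (sym (+-identityˡ _))

  ∑-distrib-+ : {A : Set} (xs : List A) (f g : A → ℤ) → ∑ xs (λ x → f x + g x) ≡ ∑ xs f + ∑ xs g
  ∑-distrib-+ []       f g = refl
  ∑-distrib-+ (x ∷ xs) f g = trans (cong (_+_ (f x + g x)) (∑-distrib-+ xs f g)) (interchange (f x) (g x) _ _)

  ∑-distrib-* : {A : Set} (xs : List A) (c : ℤ) (f : A → ℤ) → ∑ xs (λ x → c * f x) ≡ c * ∑ xs f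
  ∑-distrib-* []       c f = sym (*-zeroʳ c)
  ∑-distrib-* (x ∷ xs) c f = trans (cong (_+_ (c * f x)) (∑-distrib-* xs c f)) (sym (*-distribˡ-+ c (f x) _))

  ∑-zero : {A : Set} (xs : List A) → ∑ xs (λ _ → 0ℤ) ≡ 0ℤ
  ∑-zero []       = refl
  ∑-zero (x ∷ xs) = trans (+-identityˡ _) (∑-zero xs)

  ∑-comm : {A B : Set} (xs : List A) (ys : List B) (f : A → B → ℤ) →
    ∑ xs (λ x → ∑ ys (f x)) ≡ ∑ ys (λ y → ∑ xs (λ x → f x y))
  ∑-comm []       ys f = sym (∑-zero ys)
  ∑-comm (x ∷ xs) ys f = trans (cong (_+_ (∑ ys (f x))) (∑-comm xs ys f)) (sym (∑-distrib-+ ys (f x) _))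

  ∑-++ : {A : Set} (xs ys : List A) (f : A → ℤ) → ∑ (xs ++ ys) f ≡ ∑ xs f + ∑ ys f
  ∑-++ []       ys f = sym (+-identityˡ _)
  ∑-++ (x ∷ xs) ys f = trans (cong (_+_ (f x)) (∑-++ xs ys f)) (sym (+-assoc (f x) _ _))

  ∑-map : {A B : Set} (g : A → B) (xs : List A) (f : B → ℤ) → ∑ (map g xs) f ≡ ∑ xs (λ x → f (g x))
  ∑-map g []       f = refl
  ∑-map g (x ∷ xs) f = cong (_+_ (f (g x))) (∑-map g xs f)

  ∑-cartesianProduct : {A B : Set} (xs : List A) (ys : List B) (f : A × B → ℤ) →
    ∑ (cartesianProduct xs ys) f ≡ ∑ xs (λ x → ∑ ys (λ y → f (x , y)))
  ∑-cartesianProduct []       ys f = refl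
  ∑-cartesianProduct (x ∷ xs) ys f =
    trans (∑-++ (map (x ,_) ys) (cartesianProduct xs ys) f)
          (cong₂ _+_ (∑-map (x ,_) ys f) (∑-cartesianProduct xs ys f))

  -- The passage from integer sums over lists to natural sums. The list is consumed from the front
  -- but `Σ<` recurses at its last index, so the induction splits off the first summand by `Σ<-+ 1`.
  ∑-applyUpTo : {A : Set} (f : ℕ → A) (n : ℕ) {g : A → ℤ} {h : ℕ → ℕ} →
    (∀ i → g (f i) ≡ + h i) → ∑ (applyUpTo f n) g ≡ + Σ< n h
  ∑-applyUpTo f ℕ.zero    g≡h = refl
  ∑-applyUpTo f (ℕ.suc n) {h = h} g≡h =
    trans (cong₂ _+_ (g≡h 0) (∑-applyUpTo (λ i → f (ℕ.suc i)) n (λ i → g≡h (ℕ.suc i))))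
          (cong +_ (sym (Σ<-+ 1 n h)))

  ∑-tabulate : {A : Set} (n : ℕ) (f : Fin n → A) {g : A → ℤ} {h : ℕ → ℕ} →
    (∀ i → g (f i) ≡ + h (toℕ i)) → ∑ (tabulate f) g ≡ + Σ< n h
  ∑-tabulate ℕ.zero    f g≡h = refl
  ∑-tabulate (ℕ.suc n) f {h = h} g≡h =
    trans (cong₂ _+_ (g≡h zero) (∑-tabulate n (λ i → f (suc i)) (λ i → g≡h (suc i))))
          (cong +_ (sym (Σ<-+ 1 n h)))

-- Running times in a feasible solution of (IP).

module Schedule (I : Instance) (p≥1 : ∀ j → 1 ℕ.≤ Instance.p I j)
  (x : Fin (Instance.n I) → ℕ → Bool) (feasible : MinimizationProblem.Feasible (IP I) x) where

  open import Data.Bool.Base using (true; false; if_then_else_; b≤b; f≤t)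
  import Data.Integer.Base as ℤ
  import Data.Integer.Properties as ℤ
  open import Data.Nat.Base
  open import Data.Nat.Properties
  open import Data.List.Base using (map; upTo)
  open import Data.List.Extrema.Nat using (xs≤max)
  open import Data.List.Membership.Propositional using (_∈_)
  open import Data.List.Membership.Propositional.Properties using (∈-allFin; ∈-map⁺; ∈-filter⁺)
  import Data.List.Relation.Unary.All as All
  open import Data.Product.Base using (_,_; proj₁; proj₂)
  open import Data.Sum.Base using (inj₁; inj₂)
  open import Function.Base using (id)
  open import Relation.Binary.PropositionalEquality hiding (J)
  open import Relation.Nullary.Decidable using (does; yes; no; dec-true; dec-false)
  open import Relation.Nullary.Negation using (contradiction)
  open Instance I
  open Arithmetic
  open IntegerSums

  bit : Bool → ℕ
  bit b = if b then 1 else 0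

  val≡bit : ∀ b → val b ≡ + bit b
  val≡bit true  = refl
  val≡bit false = refl

  bit≤1 : ∀ b → bit b ≤ 1
  bit≤1 true  = ≤-refl
  bit≤1 false = z≤n

  r≤T : ∀ j → r j ≤ T
  r≤T j = ≤-trans (All.lookup (xs≤max 0 (map r J)) (∈-map⁺ r (∈-allFin j))) (m≤m+n rmax ∑p)

  -- The covering constraint for s = t = r j has no slack.
  at-release : ∀ j → x j (r j) ≡ true
  at-release j with x j (r j) in xj≡
  ... | true  = refl
  ... | false = contradiction (proj₁ feasible (r j) (r j) ≤-refl (r≤T j)) (ℤ.<⇒≱ (begin-strict
    ∑ rel (λ i → val (x i (r j)) ℤ.* + p i)           <⟨ ∑-strict-mono val*p≤p j∈rel val*p<p ⟩
    ∑ rel (λ i → + p i)                               ≡⟨ ℤ.+-identityʳ (∑ rel (λ i → + p i)) ⟨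
    ∑ rel (λ i → + p i) ℤ.- ℤ.0ℤ                      ≡⟨ cong (λ d → ∑ rel (λ i → + p i) ℤ.- d) (ℤ.+-inverseʳ (+ r j)) ⟨
    demand (r j) (r j)                                ∎))
    where
    open ℤ.≤-Reasoning
    rel = released (r j) (r j)
    j∈rel : j ∈ rel
    j∈rel = ∈-filter⁺ _ (∈-allFin j) (≤-refl , ≤-refl)
    val*p≤p : ∀ i → val (x i (r j)) ℤ.* + p i ℤ.≤ + p i
    val*p≤p i with x i (r j)
    ... | true  = ℤ.≤-reflexive (ℤ.*-identityˡ (+ p i))
    ... | false = ℤ.+≤+ z≤n
    val*p<p : val (x j (r j)) ℤ.* + p j ℤ.< + p j
    val*p<p rewrite xj≡ = ℤ.+<+ (p≥1 j)

  -- Induction downwards from `t`. The monotonicity constraint of (IP) applies only after the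
  -- release time, so the step from `r j + 1` to `r j` rests on `at-release`.
  running-before : ∀ j {s t} → r j ≤ s → s ≤ t → t ≤ T → x j t ≡ true → x j s ≡ true
  running-before j {s} {t} r≤s s≤t t≤T xt with m≤n⇒m<n∨m≡n s≤t
  ... | inj₂ refl = xt
  running-before j {s} {suc t} r≤s s≤t t≤T xt | inj₁ (s≤s s≤t′) with m≤n⇒m<n∨m≡n (≤-trans r≤s s≤t′)
  ... | inj₂ refl = subst (λ u → x j u ≡ true) (≤-antisym r≤s s≤t′) (at-release j)
  ... | inj₁ r<t  = running-before j r≤s s≤t′ (<⇒≤ t≤T) (≤-true (proj₂ feasible j t r<t t≤T) xt)
    where
    ≤-true : ∀ {a b} → a Data.Bool.Base.≤ b → a ≡ true → b ≡ true
    ≤-true b≤b eq = eq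
    ≤-true f≤t eq = refl

  -- Values of `x` before the release time are not variables of (IP), so they count as 0.
  runs : Fin n → ℕ → ℕ
  runs j t = if does (r j ≤? t) then bit (x j t) else 0

  duration : Fin n → ℕ
  duration j = Σ< (suc T) (runs j)

  runs≡bit : ∀ j {t} → r j ≤ t → runs j t ≡ bit (x j t)
  runs≡bit j {t} r≤t rewrite dec-true (r j ≤? t) r≤t = refl

  runs≡0 : ∀ j {t} → t < r j → runs j t ≡ 0
  runs≡0 j {t} t<r rewrite dec-false (r j ≤? t) (<⇒≱ t<r) = refl

  -- A job running at `t` has run throughout from `r j` to `t`, and these `t - r j + 1` steps are
  -- all counted in its duration.
  running⇒< : ∀ j {t} → r j ≤ t → t ≤ T → x j t ≡ true → t < r j + duration j
  running⇒< j {t} r≤t t≤T xt =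
    ≤-trans (count (suc t) ≤-refl) (+-monoʳ-≤ (r j) (Σ<-monoʳ-≤ (runs j) (s≤s t≤T)))
    where
    open ≤-Reasoning
    count : ∀ k → k ≤ suc t → k ≤ r j + Σ< k (runs j)
    count zero    _ = z≤n
    count (suc k) 1+k≤1+t with r j ≤? k
    ... | no r≰k  = ≤-trans (≰⇒> r≰k) (m≤m+n (r j) _)
    ... | yes r≤k = begin
      suc k                              ≤⟨ s≤s (count k (<⇒≤ 1+k≤1+t)) ⟩
      suc (r j + Σ< k (runs j))          ≡⟨ +-comm 1 _ ⟩
      r j + Σ< k (runs j) + 1            ≡⟨ +-assoc (r j) _ 1 ⟩
      r j + (Σ< k (runs j) + 1)          ≡⟨ cong (λ c → r j + (Σ< k (runs j) + c)) (trans (runs≡bit j r≤k) (cong bit (running-before j r≤k (s≤s⁻¹ 1+k≤1+t) t≤T xt))) ⟨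
      r j + (Σ< k (runs j) + runs j k)   ∎

  1≤duration : ∀ j → 1 ≤ duration j
  1≤duration j = +-cancelˡ-≤ (r j) 1 (duration j)
    (≤-trans (≤-reflexive (+-comm (r j) 1)) (running⇒< j ≤-refl (r≤T j) (at-release j)))

  -- The times from `r j` to `T` inclusive are `suc T ∸ r j` many, which is where the extra 1 comes
  -- from.
  r+duration≤1+T : ∀ j → r j + duration j ≤ suc T
  r+duration≤1+T j = begin
    r j + duration j        ≤⟨ +-monoʳ-≤ (r j) (count (suc T)) ⟩
    r j + (suc T ∸ r j)     ≡⟨ m+[n∸m]≡n (m≤n⇒m≤1+n (r≤T j)) ⟩
    suc T                   ∎
    where
    open ≤-Reasoning
    count : ∀ k → Σ< k (runs j) ≤ k ∸ r j
    count zero    = z≤n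
    count (suc k) with r j ≤? k
    ... | no r≰k  = begin
      Σ< k (runs j) + runs j k     ≡⟨ cong (_+_ (Σ< k (runs j))) (runs≡0 j (≰⇒> r≰k)) ⟩
      Σ< k (runs j) + 0            ≡⟨ +-identityʳ _ ⟩
      Σ< k (runs j)                ≤⟨ count k ⟩
      k ∸ r j                      ≤⟨ ∸-monoˡ-≤ (r j) (n≤1+n k) ⟩
      suc k ∸ r j                  ∎
    ... | yes r≤k = begin
      Σ< k (runs j) + runs j k     ≤⟨ +-mono-≤ (count k) (≤-trans (≤-reflexive (runs≡bit j r≤k)) (bit≤1 (x j k))) ⟩
      k ∸ r j + 1                  ≡⟨ +-comm (k ∸ r j) 1 ⟩
      suc (k ∸ r j)                ≡⟨ +-∸-assoc 1 r≤k ⟨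
      suc k ∸ r j                  ∎

  cost-IP : MinimizationProblem.cost (IP I) x ≡ ∑ J (λ j → + (w j * duration j))
  cost-IP = ∑-cong J λ j → trans (∑-filter (r j ≤?_) (upTo (suc T)) _)
    (trans (∑-applyUpTo id (suc T) (term j)) (cong +_ (Σ<-distrib-* (suc T) (w j) (runs j))))
    where
    term : ∀ j t → (if does (r j ≤? t) then + w j ℤ.* val (x j t) else ℤ.0ℤ) ≡ + (w j * runs j t)
    term j t with does (r j ≤? t)
    ... | true  = trans (cong (+ w j ℤ.*_) (val≡bit (x j t))) (sym (ℤ.pos-* (w j) (bit (x j t))))
    ... | false = cong +_ (sym (*-zeroʳ (w j)))

-- Rounding to a solution of (IP2) for fixed offsets.

module Rounding (N : ℕ) .{{_ : NonTrivial N}} (l : ℕ) (o : Offsets N (ℕ.suc l)) (I : Instance)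
  (m : Fin (Instance.n I) → ℕ) where

  open import Data.Bool.Base using (true; false; if_then_else_)
  import Data.Bool.Base as Bool
  import Data.Bool.Properties as Bool
  open import Data.Fin.Base using (toℕ)
  open import Data.Fin.Properties using (toℕ<n)
  import Data.Integer.Base as ℤ
  import Data.Integer.Properties as ℤ
  open import Data.Nat.Base
  open import Data.Nat.Properties
  open import Data.Nat.DivMod using (m/n*n≡m; m/n*n≤m; m<n*o⇒m/o<n; _/_)
  open import Data.Nat.Divisibility using (_∣_; divides; 1∣_)
  open import Data.Nat.Tactic.RingSolver using (solve-∀)
  open import Data.List.Base using (applyUpTo; filter)
  open import Data.List.Membership.Propositional using (_∈_)
  open import Data.List.Membership.Propositional.Properties using (∈-applyUpTo⁺; ∈-applyUpTo⁻; ∈-upTo⁺; ∈-filter⁺; ∈-filter⁻)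
  open import Data.Product.Base using (∃-syntax; _×_; _,_; proj₁; proj₂)
  open import Function.Base using (id)
  open import Relation.Binary.PropositionalEquality hiding (J)
  open import Relation.Nullary.Decidable using (does; yes; no; dec-true; dec-false)
  open import Relation.Nullary.Negation using (¬_; contradiction)
  open import Algebra.Bundles using (AbelianGroup)
  open import Algebra.Properties.Group (AbelianGroup.group ℤ.+-0-abelianGroup) using (∙-cancelʳ)
  open Instance I
  open Grid N (suc l) o
  open Segments I
  open Arithmetic
  open IntegerSums
  open Endpoints cellLen cellLen≢0

  a : ℕ
  a = toℕ (proj₁ o)

  -- Shifting time by `a`, the negative of `off-x`, moves the cell boundaries to multiples of the
  -- cell lengths, and the release time to the natural number `r j + a`.
  dist : Fin n → ℕ → ℕ
  dist j = endDist (r j + a)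

  end-cellAt : ∀ h v → end (cellAt h (+ v)) ℤ.+ + a ≡ + (suc (_/_ (v + a) (cellLen h) {{cellLen≢0 h}}) * cellLen h)
  end-cellAt h v = begin
    (ℤ.- + a ℤ.+ ((+ v ℤ.- (ℤ.- + a)) ℤ./ℕ L ℤ.+ ℤ.1ℤ) ℤ.* + L) ℤ.+ + a
      -- Once the double negation is gone, the dividend is the natural number `v + a`, on which `/ℕ`
      -- computes to the quotient `q`.
      ≡⟨ cong (λ z → (ℤ.- + a ℤ.+ ((+ v ℤ.+ z) ℤ./ℕ L ℤ.+ ℤ.1ℤ) ℤ.* + L) ℤ.+ + a) (ℤ.neg-involutive (+ a)) ⟩
    (ℤ.- + a ℤ.+ + (q + 1) ℤ.* + L) ℤ.+ + a
      ≡⟨ cong (ℤ._+ + a) (ℤ.+-comm (ℤ.- + a) (+ (q + 1) ℤ.* + L)) ⟩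
    (+ (q + 1) ℤ.* + L ℤ.+ ℤ.- + a) ℤ.+ + a
      ≡⟨ ℤ.+-assoc (+ (q + 1) ℤ.* + L) (ℤ.- + a) (+ a) ⟩
    + (q + 1) ℤ.* + L ℤ.+ (ℤ.- + a ℤ.+ + a)
      ≡⟨ cong (ℤ._+_ (+ (q + 1) ℤ.* + L)) (ℤ.+-inverseˡ (+ a)) ⟩
    + (q + 1) ℤ.* + L ℤ.+ ℤ.0ℤ
      ≡⟨ ℤ.+-identityʳ (+ (q + 1) ℤ.* + L) ⟩
    + (q + 1) ℤ.* + L
      ≡⟨ ℤ.pos-* (q + 1) L ⟨
    + ((q + 1) * L)
      ≡⟨ cong (λ z → + (z * L)) (+-comm q 1) ⟩
    + (suc q * L) ∎
    where
    open ≡-Reasoning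
    L = cellLen h
    instance _ = cellLen≢0 h
    q = (v + a) / L

  swap : ∀ x y z → x + y + z ≡ x + z + y
  swap = solve-∀

  end-cellAt-dist : ∀ j h → end (cellAt h (+ (r j + dist j h))) ≡ + (r j + dist j (suc h))
  end-cellAt-dist j h = ∙-cancelʳ (+ a) _ _ (begin
    end (cellAt h (+ (r j + dist j h))) ℤ.+ + a                  ≡⟨ end-cellAt h (r j + dist j h) ⟩
    + (suc ((r j + dist j h + a) / cellLen h) * cellLen h)       ≡⟨ cong (λ u → + (suc (u / cellLen h) * cellLen h)) (swap (r j) (dist j h) a) ⟩
    + (suc ((r j + a + dist j h) / cellLen h) * cellLen h)       ≡⟨ cong +_ (end≡ (r j + a) h) ⟨
    + (r j + a + dist j (suc h))                                 ≡⟨ cong +_ (swap (r j) a (dist j (suc h))) ⟩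
    + (r j + dist j (suc h) + a)                                 ∎)
    where
    open ≡-Reasoning
    instance _ = cellLen≢0 h

  end-C : ∀ j h → end (C j h) ≡ + (r j + dist j (suc h))
  end-C j zero    = trans (cong (λ v → end (cellAt 0 (+ v))) (sym (+-identityʳ (r j)))) (end-cellAt-dist j 0)
  end-C j (suc h) = trans (cong (λ q → end (cellAt (suc h) q)) (end-C j h)) (end-cellAt-dist j (suc h))

  part≡ : ∀ j h → part j h ≡ [ + (r j + dist j h) , + (r j + dist j (suc h)) ⟩
  part≡ j zero    = cong₂ [_,_⟩ (cong +_ (sym (+-identityʳ (r j)))) (end-C j 0)
  part≡ j (suc h) = cong₂ [_,_⟩ (end-C j h) (end-C j (suc h))

  seg : Fin n → ℕ → ℕ → Interval
  seg j h i = [ + (r j + dist j h + i * segLen h) , + (r j + dist j h + suc i * segLen h) ⟩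

  count : Fin n → ℕ → ℕ
  count j h = _/_ (dist j (suc h) ∸ dist j h) (segLen h) {{segLen≢0 h}}

  dist-≤ : ∀ j h → dist j h ≤ dist j (suc h)
  dist-≤ j h = <⇒≤ (endDist-< (r j + a) h)

  Seg≡ : ∀ j h → Seg j h ≡ applyUpTo (seg j h) (count j h)
  Seg≡ j h = trans (cong (λ A → subdivide A (segLen h)) (part≡ j h))
                   (cong (λ k → applyUpTo (seg j h) (k / segLen h)) length≡)
    where
    instance _ = segLen≢0 h
    length≡ : ℤ.∣ + (r j + dist j (suc h)) ℤ.- + (r j + dist j h) ∣ ≡ dist j (suc h) ∸ dist j h
    length≡ = trans (cong ℤ.∣_∣ (trans (ℤ.[+m]-[+n]≡m⊖n (r j + dist j (suc h)) (r j + dist j h))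
                                       (ℤ.⊖-≥ (+-monoʳ-≤ (r j) (dist-≤ j h)))))
                    ([m+n]∸[m+o]≡n∸o (r j) (dist j (suc h)) (dist j h))

  ∈Seg⇒≡seg : ∀ j h {S} → S ∈ Seg j h → ∃[ i ] S ≡ seg j h i
  ∈Seg⇒≡seg j h S∈ with ∈-applyUpTo⁻ (seg j h) (subst (_ ∈_) (Seg≡ j h) S∈)
  ... | i , _ , S≡ = i , S≡

  seg∈Seg : ∀ j h {i} → i < count j h → seg j h i ∈ Seg j h
  seg∈Seg j h {i} i<k = subst (seg j h i ∈_) (sym (Seg≡ j h)) (∈-applyUpTo⁺ (seg j h) i<k)

  cellLen-∣ : ∀ h → cellLen h ∣ cellLen (suc h)
  cellLen-∣ h = divides (K N) (shift (off-y N (suc l) o) (K N) (K N ^ h))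
    where
    shift : ∀ x y z → x * (y * z) ≡ y * (x * z)
    shift = solve-∀

  -- This is why `subdivide` leaves no remainder. From height 2 on, both ends of a part are, after
  -- the shift, multiples of longer cell lengths, hence of the cell length two heights below.
  segLen-∣ : ∀ j h → segLen h ∣ dist j (suc h) ∸ dist j h
  segLen-∣ j zero          = 1∣ _
  segLen-∣ j (suc zero)    = 1∣ _
  segLen-∣ j (suc (suc h)) = ∣-gap (r j + a) cellLen-∣ (suc h) (cellLen-∣ h)

  count-segLen : ∀ j h → dist j h + count j h * segLen h ≡ dist j (suc h)
  count-segLen j h = trans (cong (_+_ (dist j h)) (m/n*n≡m {{segLen≢0 h}} (segLen-∣ j h))) (m+[n∸m]≡n (dist-≤ j h))

  -- This lets the rounding error of a part be charged to the distance at which the part begins.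
  -- Unit segments have no error; from height 2 on, `L≤endDist` applies.
  segLen≤dist : ∀ j h → segLen h ∸ 1 ≤ dist j h
  segLen≤dist j zero          = z≤n
  segLen≤dist j (suc zero)    = z≤n
  segLen≤dist j (suc (suc h)) = ≤-trans (m∸n≤m (cellLen h) 1) (L≤endDist (r j + a) cellLen-∣ h)

  y : Fin n → Interval → Bool
  y j S = does (beg S ℤ.<? + (r j + m j))

  -- Segments in one `Seg j h` have equal length, so their ends and their starts are ordered alike,
  -- and `y` is a threshold on the start.
  y-monotone : ∀ j h S S′ → S ∈ Seg j h → S′ ∈ Seg j h → end S ℤ.< end S′ → y j S′ Bool.≤ y j S
  y-monotone j h S S′ S∈ S′∈ S<S′ with ∈Seg⇒≡seg j h S∈ | ∈Seg⇒≡seg j h S′∈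
  ... | i , refl | i′ , refl with beg S′ ℤ.<? + (r j + m j)
  ...   | no ¬lt = subst (Bool._≤ y j S) (sym (dec-false (_ ℤ.<? _) ¬lt)) (Bool.≤-minimum (y j S))
  ...   | yes lt = subst (y j S′ Bool.≤_) (sym (dec-true (_ ℤ.<? _) (ℤ.<-trans beg< lt))) (Bool.≤-maximum (y j S′))
    where
    s = segLen h
    instance _ = segLen≢0 h
    i<i′ : i < i′
    i<i′ = s<s⁻¹ (*-cancelʳ-< s (suc i) (suc i′) (+-cancelˡ-< (r j + dist j h) _ _ (ℤ.drop‿+<+ S<S′)))
    beg< : beg S ℤ.< beg S′
    beg< = ℤ.+<+ (+-monoʳ-< (r j + dist j h) (*-monoˡ-< s i<i′))

  locate : ∀ (e : ℕ → ℕ) k {d} → e 0 ≤ d → d < e k → ∃[ h ] (h < k × e h ≤ d × d < e (suc h))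
  locate e zero    e0≤d d<e0 = contradiction e0≤d (<⇒≱ d<e0)
  locate e (suc k) {d} e0≤d d<e with e k ≤? d
  ... | yes ek≤d = k , ≤-refl , ek≤d , d<e
  ... | no  ek≰d with locate e k e0≤d (≰⇒> ek≰d)
  ...   | h , h<k , rest = h , m<n⇒m<1+n h<k , rest

  -- The parts tile the time from `r j` to at least `r j + m j`. The segment containing `t` begins
  -- no later than `t`, hence before `r j + m j`, and so is selected.
  covered : ∀ j → m j ≤ dist j (2 + l) → ∀ {t} → r j ≤ t → t < r j + m j →
    ∃[ h ] ∃[ S ] (h ∈ heights × S ∈ Seg j h × S ∋ + t × y j S ≡ true)
  covered j m≤ {t} r≤t t< with locate (dist j) (2 + l) {t ∸ r j} z≤n
    (<-≤-trans (+-cancelˡ-< (r j) _ _ (≤-<-trans (≤-reflexive (m+[n∸m]≡n r≤t)) t<)) m≤)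
  ... | h , h<k , e≤d , d<e′ =
    h , seg j h i , ∈-upTo⁺ h<k , seg∈Seg j h i<count ,
    (ℤ.+≤+ beg≤t , ℤ.+<+ t<end) , dec-true (_ ℤ.<? _) (ℤ.+<+ (≤-<-trans beg≤t t<))
    where
    s = segLen h
    instance _ = segLen≢0 h
    e = dist j h
    d = t ∸ r j
    i = (d ∸ e) / s
    t≡ : t ≡ r j + e + (d ∸ e)
    t≡ = sym (trans (+-assoc (r j) e (d ∸ e)) (trans (cong (_+_ (r j)) (m+[n∸m]≡n e≤d)) (m+[n∸m]≡n r≤t)))
    i<count : i < count j h
    i<count = m<n*o⇒m/o<n (≤-trans (∸-monoˡ-< d<e′ e≤d) (≤-reflexive (sym (m/n*n≡m (segLen-∣ j h)))))
    beg≤t : r j + e + i * s ≤ t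
    beg≤t = ≤-trans (+-monoʳ-≤ (r j + e) (m/n*n≤m (d ∸ e) s)) (≤-reflexive (sym t≡))
    t<end : t < r j + e + suc i * s
    t<end = ≤-<-trans (≤-reflexive t≡) (+-monoʳ-< (r j + e) (u<[1+u/d]*d (d ∸ e) s))

  segCost-piece : ∀ j h i → segCost j h (seg j h i) ℤ.* val (y j (seg j h i)) ≡ + (w j * piece (dist j h) (segLen h) (m j) i)
  segCost-piece j h i with dist j h + i * segLen h <? m j
  ... | no ¬lt = begin
    segCost j h S ℤ.* val (y j S)           ≡⟨ cong (λ b → segCost j h S ℤ.* val b) (dec-false (beg S ℤ.<? _) beg≮) ⟩
    segCost j h S ℤ.* ℤ.0ℤ                  ≡⟨ ℤ.*-zeroʳ (segCost j h S) ⟩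
    ℤ.0ℤ                                    ≡⟨ cong +_ (*-zeroʳ (w j)) ⟨
    + (w j * 0)                             ≡⟨ cong (λ c → + (w j * c)) (piece-≥ i (≮⇒≥ ¬lt)) ⟨
    + (w j * piece (dist j h) (segLen h) (m j) i) ∎
    where
    open ≡-Reasoning
    S = seg j h i
    beg≮ : ¬ (beg S ℤ.< + (r j + m j))
    beg≮ (ℤ.+<+ lt) = ¬lt (+-cancelˡ-< (r j) _ _ (≤-<-trans (≤-reflexive (sym (+-assoc (r j) _ _))) lt))
  ... | yes lt = begin
    segCost j h S ℤ.* val (y j S)           ≡⟨ cong (λ b → segCost j h S ℤ.* val b) (dec-true (beg S ℤ.<? _) beg<) ⟩
    segCost j h S ℤ.* ℤ.1ℤ                  ≡⟨ ℤ.*-identityʳ (segCost j h S) ⟩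
    segCost j h S                           ≡⟨ cong (+ w j ℤ.*_) (base i) ⟩
    + w j ℤ.* + pieceLen (dist j h) (segLen h) i ≡⟨ ℤ.pos-* (w j) _ ⟨
    + (w j * pieceLen (dist j h) (segLen h) i)   ≡⟨ cong (λ c → + (w j * c)) (piece-< i lt) ⟨
    + (w j * piece (dist j h) (segLen h) (m j) i) ∎
    where
    open ≡-Reasoning
    S = seg j h i
    beg< : beg S ℤ.< + (r j + m j)
    beg< = ℤ.+<+ (≤-<-trans (≤-reflexive (+-assoc (r j) _ _)) (+-monoʳ-< (r j) lt))
    [+x+y]-[+x] : ∀ x y → + (x + y) ℤ.- + x ≡ + y
    [+x+y]-[+x] x y = trans (ℤ.[+m]-[+n]≡m⊖n (x + y) x) (trans (ℤ.⊖-≥ (m≤m+n x y)) (cong +_ (m+n∸m≡n x y)))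
    -- Positive segment lengths make the test for the leftmost segment succeed at index 0 only.
    base : ∀ i → let S = seg j h i in
      (if does (beg S ℤ.≟ beg (part j h)) then end S ℤ.- + r j else len S) ≡ + pieceLen (dist j h) (segLen h) i
    base zero = trans
      (cong (λ b → if b then end (seg j h 0) ℤ.- + r j else len (seg j h 0))
            (dec-true (_ ℤ.≟ _) (trans (cong +_ (+-identityʳ _)) (sym (cong beg (part≡ j h))))))
      (trans (cong (λ u → + u ℤ.- + r j) (trans (cong (_+_ (r j + dist j h)) (+-identityʳ (segLen h))) (+-assoc (r j) _ _)))
             ([+x+y]-[+x] (r j) (dist j h + segLen h)))
    base (suc i) = trans
      (cong (λ b → if b then end (seg j h (suc i)) ℤ.- + r j else len (seg j h (suc i)))
            (dec-false (_ ℤ.≟ _) beg≢))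
      (trans (cong (λ u → + u ℤ.- beg (seg j h (suc i))) (regroup (r j + dist j h) (segLen h) (i * segLen h)))
             ([+x+y]-[+x] (r j + dist j h + suc i * segLen h) (segLen h)))
      where
      regroup : ∀ x s t → x + (s + (s + t)) ≡ x + (s + t) + s
      regroup = solve-∀
      beg≢ : beg (seg j h (suc i)) ≢ beg (part j h)
      beg≢ eq = <⇒≢ (m<m+n (r j + dist j h) (≤-trans (>-nonZero⁻¹ (segLen h) {{segLen≢0 h}}) (m≤m+n (segLen h) (i * segLen h))))
        (sym (ℤ.+-injective (trans eq (cong beg (part≡ j h)))))

  overrun : Fin n → ℕ
  overrun j = Σ< (suc l) (λ h → below (m j) (dist j (suc h)))

  cost-y : (∀ j → m j ≤ dist j (2 + l)) →
    MinimizationProblem.cost (IP2 N I (suc l) o) y ℤ.≤ ∑ J (λ j → + (w j * (m j + 2 * overrun j)))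
  cost-y m≤ = ∑-mono J λ {j} _ → begin
    ∑ heights (λ h → ∑ (Seg j h) (λ S → segCost j h S ℤ.* val (y j S)))
      ≡⟨ ∑-applyUpTo id (2 + l) (λ h → trans (cong (λ Ss → ∑ Ss (λ S → segCost j h S ℤ.* val (y j S))) (Seg≡ j h))
           (trans (∑-applyUpTo (seg j h) (count j h) (segCost-piece j h)) (cong +_ (Σ<-distrib-* (count j h) (w j) _)))) ⟩
    + Σ< (2 + l) (λ h → w j * Σ< (count j h) (piece (dist j h) (segLen h) (m j)))
      ≡⟨ cong +_ (Σ<-distrib-* (2 + l) (w j) _) ⟩
    + (w j * Σ< (2 + l) (λ h → Σ< (count j h) (piece (dist j h) (segLen h) (m j))))
      ≤⟨ ℤ.+≤+ (*-monoʳ-≤ (w j) (Σ<-parts-≤ (m j) (suc l) (dist j) segLen (count j) refl (count-segLen j) (segLen≤dist j) (m≤ j))) ⟩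
    + (w j * (m j + 2 * overrun j)) ∎
    where open ℤ.≤-Reasoning

  -- Both programs have the same demands, so jobs can be compared one by one: the segment found by
  -- `covered` alone contributes `p j`, and all other terms are nonnegative.
  feasible-y : (∀ j → m j ≤ dist j (2 + l)) → (x : Fin n → ℕ → Bool) → MinimizationProblem.Feasible (IP I) x →
    (∀ j {t} → r j ≤ t → t ≤ T → x j t ≡ true → t < r j + m j) → MinimizationProblem.Feasible (IP2 N I (suc l) o) y
  feasible-y m≤ x (covers , _) running⇒< = (λ s t s≤t t≤T → ℤ.≤-trans (covers s t s≤t t≤T)
      (∑-mono (released s t) (λ {j} j∈ → job j (proj₂ (proj₂ (∈-filter⁻ _ {xs = J} j∈))) t≤T)))
    , λ j h _ → y-monotone j h
    where
    0≤val*p : ∀ b j → ℤ.0ℤ ℤ.≤ val b ℤ.* + p j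
    0≤val*p true  j = ℤ.≤-trans (ℤ.+≤+ z≤n) (ℤ.≤-reflexive (sym (ℤ.*-identityˡ (+ p j))))
    0≤val*p false j = ℤ.+≤+ z≤n
    job : ∀ j {t} → r j ≤ t → t ≤ T →
      val (x j t) ℤ.* + p j ℤ.≤ ∑ heights (λ h → ∑ (filter (_∋? + t) (Seg j h)) (λ S → val (y j S) ℤ.* + p j))
    job j {t} r≤t t≤T with x j t in xt
    ... | false = 0≤∑ heights (λ h → 0≤∑ (filter (_∋? + t) (Seg j h)) (λ S → 0≤val*p (y j S) j))
    ... | true with covered j (m≤ j) r≤t (running⇒< j r≤t t≤T xt)
    ...   | h , S , h∈ , S∈ , S∋t , yS = begin
      val true ℤ.* + p j                                            ≡⟨ cong (λ b → val b ℤ.* + p j) yS ⟨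
      val (y j S) ℤ.* + p j                                         ≤⟨ term≤∑ (λ S′ → 0≤val*p (y j S′) j) (∈-filter⁺ (_∋? + t) S∈ S∋t) ⟩
      ∑ (filter (_∋? + t) (Seg j h)) (λ S → val (y j S) ℤ.* + p j)  ≤⟨ term≤∑ (λ h → 0≤∑ (filter (_∋? + t) (Seg j h)) (λ S → 0≤val*p (y j S) j)) h∈ ⟩
      _                                                             ∎
      where open ℤ.≤-Reasoning

  -- After the shift the topmost end is at least `K N ^ suc l`, whereas `T` and `suc a` are both at
  -- most `K N ^ l`; as `2 ≤ K N`, the chain of cells outlasts the run.
  m≤dist : ∀ j {T} → 1 ≤ T → T * K N ≤ K N ^ l → r j + m j ≤ suc T → m j ≤ dist j (2 + l)
  m≤dist j {T} 1≤T TK≤R r+m≤ = +-cancelˡ-≤ (r j + a) _ _ (begin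
    r j + a + m j                     ≡⟨ swap (r j) a (m j) ⟩
    r j + m j + a                     ≤⟨ +-monoˡ-≤ a r+m≤ ⟩
    suc T + a                         ≡⟨ +-suc T a ⟨
    T + suc a                         ≤⟨ +-mono-≤ (≤-trans (m≤m*n T (K N)) TK≤R) (toℕ<n (proj₁ o)) ⟩
    K N ^ l + K N ^ l                 ≡⟨ cong (_+_ (K N ^ l)) (+-identityʳ (K N ^ l)) ⟨
    2 * K N ^ l                       ≤⟨ *-monoˡ-≤ (K N ^ l) (2≤[2n]^n N) ⟩
    K N ^ suc l                       ≤⟨ m≤n*m (K N ^ suc l) (2/ε N ^ toℕ (proj₂ o)) ⟩
    cellLen (suc l)                   ≤⟨ L≤end (r j + a) (suc l) ⟩
    r j + a + dist j (2 + l)          ∎)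
    where
    open ≤-Reasoning
    instance
      _ : NonZero N
      _ = nonTrivial⇒nonZero N
      D≢0 : NonZero (2/ε N)
      D≢0 = m*n≢0 2 N
      _ : NonZero (K N)
      _ = m^n≢0 (2/ε N) N
      D^≢0 : NonZero (2/ε N ^ toℕ (proj₂ o))
      D^≢0 = m^n≢0 (2/ε N) (toℕ (proj₂ o))

-- Expectation over the offsets and the final bound.

module Expectation where

  import Data.Integer.Base as ℤ
  import Data.Integer.Properties as ℤ
  open import Data.Integer.Tactic.RingSolver using () renaming (solve-∀ to solve-∀ℤ)
  open import Data.List.Base using (_∷_; allFin; cartesianProduct)
  open import Data.List.Membership.Propositional using (_∈_)
  open import Data.List.Membership.Propositional.Properties using (∈-allFin; ∈-map⁺)
  open import Data.List.Relation.Unary.Any using (here; there)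
  open import Data.Nat.Base
  open import Data.Nat.ListAction using (sum)
  open import Data.Nat.Properties
  open import Data.Nat.Tactic.RingSolver using (solve-∀)
  open import Data.Product.Base using (_,_; proj₂)
  import Data.Rational.Base as ℚ
  import Data.Rational.Properties as ℚ
  import Data.Rational.Unnormalised.Base as ℚᵘ
  import Data.Rational.Unnormalised.Properties as ℚᵘ
  open import Function.Base using (id)
  open import Relation.Binary.PropositionalEquality hiding (J)
  open import Relation.Nullary.Negation using (¬_; contradiction)
  open Arithmetic
  open IntegerSums

  toℚᵘ-/ : ∀ i d .{{_ : NonZero d}} → ℚ.toℚᵘ (i ℚ./ d) ℚᵘ.≃ (i ℚᵘ./ d)
  toℚᵘ-/ i (suc d) = ℚ.toℚᵘ-fromℚᵘ (ℚᵘ.mkℚᵘ i d)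

  -- This is `average-≤` cross-multiplied. The factors `1ℤ` match the numerator that unnormalised
  -- rational arithmetic produces.
  average-cross-≤ : ∀ c R N X Y → X ℤ.≤ + (R * N + c * R) ℤ.* Y →
    X ℤ.* + N ℤ.≤ (ℤ.1ℤ ℤ.* + N ℤ.+ + c ℤ.* ℤ.1ℤ ℤ.* ℤ.1ℤ) ℤ.* Y ℤ.* + (R * N)
  average-cross-≤ c R N X Y X≤ = begin
    X ℤ.* + N                                    ≤⟨ ℤ.*-monoʳ-≤-nonNeg (+ N) X≤ ⟩
    + (R * N + c * R) ℤ.* Y ℤ.* + N              ≡⟨ cong (λ z → z ℤ.* Y ℤ.* + N) (cong₂ ℤ._+_ (ℤ.pos-* R N) (ℤ.pos-* c R)) ⟩
    (+ R ℤ.* + N ℤ.+ + c ℤ.* + R) ℤ.* Y ℤ.* + N  ≡⟨ shift (+ c) (+ R) (+ N) Y ⟩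
    (ℤ.1ℤ ℤ.* + N ℤ.+ + c ℤ.* ℤ.1ℤ ℤ.* ℤ.1ℤ) ℤ.* Y ℤ.* (+ R ℤ.* + N)
      ≡⟨ cong (ℤ._*_ ((ℤ.1ℤ ℤ.* + N ℤ.+ + c ℤ.* ℤ.1ℤ ℤ.* ℤ.1ℤ) ℤ.* Y)) (ℤ.pos-* R N) ⟨
    (ℤ.1ℤ ℤ.* + N ℤ.+ + c ℤ.* ℤ.1ℤ ℤ.* ℤ.1ℤ) ℤ.* Y ℤ.* + (R * N) ∎
    where
    open ℤ.≤-Reasoning
    shift : ∀ c R N Y → (R ℤ.* N ℤ.+ c ℤ.* R) ℤ.* Y ℤ.* N ≡
      (ℤ.1ℤ ℤ.* N ℤ.+ c ℤ.* ℤ.1ℤ ℤ.* ℤ.1ℤ) ℤ.* Y ℤ.* (R ℤ.* N)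
    shift = solve-∀ℤ

  -- There are `R * N` offset pairs, and `(R * N + c * R) / (R * N)` is `1 + c / N`, where `1 / N`
  -- is ε. The proof passes to unnormalised rationals, whose numerators and denominators compute.
  average-≤ : ∀ c R N .{{_ : NonZero R}} .{{_ : NonZero N}} .{{_ : NonZero (R * N)}} X Y →
    X ℤ.≤ + (R * N + c * R) ℤ.* Y →
    X ℚ./ (R * N) ℚ.≤ (ℚ.1ℚ ℚ.+ (+ c ℚ./ 1) ℚ.* (ℤ.1ℤ ℚ./ N)) ℚ.* (Y ℚ./ 1)
  average-≤ c R@(suc _) N@(suc _) X Y X≤ = ℚ.toℚᵘ-cancel-≤ (begin
    ℚ.toℚᵘ (X ℚ./ (R * N))
      ≃⟨ toℚᵘ-/ X (R * N) ⟩
    X ℚᵘ./ (R * N)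
      ≤⟨ ℚᵘ.*≤* cross ⟩
    (ℚᵘ.1ℚᵘ ℚᵘ.+ (+ c ℚᵘ./ 1) ℚᵘ.* (ℤ.1ℤ ℚᵘ./ N)) ℚᵘ.* (Y ℚᵘ./ 1)
      ≃⟨ ℚᵘ.*-cong (ℚᵘ.+-cong (ℚᵘ.≃-refl {ℚᵘ.1ℚᵘ}) (ℚᵘ.*-cong (toℚᵘ-/ (+ c) 1) (toℚᵘ-/ ℤ.1ℤ N))) (toℚᵘ-/ Y 1) ⟨
    (ℚ.toℚᵘ ℚ.1ℚ ℚᵘ.+ ℚ.toℚᵘ (+ c ℚ./ 1) ℚᵘ.* ℚ.toℚᵘ (ℤ.1ℤ ℚ./ N)) ℚᵘ.* ℚ.toℚᵘ (Y ℚ./ 1)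
      ≃⟨ ℚᵘ.*-cong (ℚᵘ.+-cong (ℚᵘ.≃-refl {ℚᵘ.1ℚᵘ}) (ℚ.toℚᵘ-homo-* (+ c ℚ./ 1) (ℤ.1ℤ ℚ./ N))) (ℚᵘ.≃-refl {ℚ.toℚᵘ (Y ℚ./ 1)}) ⟨
    (ℚ.toℚᵘ ℚ.1ℚ ℚᵘ.+ ℚ.toℚᵘ ((+ c ℚ./ 1) ℚ.* (ℤ.1ℤ ℚ./ N))) ℚᵘ.* ℚ.toℚᵘ (Y ℚ./ 1)
      ≃⟨ ℚᵘ.*-cong (ℚ.toℚᵘ-homo-+ ℚ.1ℚ ((+ c ℚ./ 1) ℚ.* (ℤ.1ℤ ℚ./ N))) (ℚᵘ.≃-refl {ℚ.toℚᵘ (Y ℚ./ 1)}) ⟨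
    ℚ.toℚᵘ (ℚ.1ℚ ℚ.+ (+ c ℚ./ 1) ℚ.* (ℤ.1ℤ ℚ./ N)) ℚᵘ.* ℚ.toℚᵘ (Y ℚ./ 1)
      ≃⟨ ℚ.toℚᵘ-homo-* (ℚ.1ℚ ℚ.+ (+ c ℚ./ 1) ℚ.* (ℤ.1ℤ ℚ./ N)) (Y ℚ./ 1) ⟨
    ℚ.toℚᵘ ((ℚ.1ℚ ℚ.+ (+ c ℚ./ 1) ℚ.* (ℤ.1ℤ ℚ./ N)) ℚ.* (Y ℚ./ 1)) ∎)
    where
    open ℚᵘ.≤-Reasoning
    rhs = (ℚᵘ.1ℚᵘ ℚᵘ.+ (+ c ℚᵘ./ 1) ℚᵘ.* (ℤ.1ℤ ℚᵘ./ N)) ℚᵘ.* (Y ℚᵘ./ 1)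
    denominator : ℚᵘ.↧ rhs ≡ + N
    denominator = cong +_ (trans (*-identityʳ (1 * (1 * N))) (trans (*-identityˡ (1 * N)) (*-identityˡ N)))
    cross : X ℤ.* ℚᵘ.↧ rhs ℤ.≤ ℚᵘ.↥ rhs ℤ.* + (R * N)
    cross = subst₂ (λ d d′ → X ℤ.* d ℤ.≤ (ℤ.1ℤ ℤ.* d′ ℤ.+ + c ℤ.* ℤ.1ℤ ℤ.* ℤ.1ℤ) ℤ.* Y ℤ.* + (R * N))
      (sym denominator) (cong +_ (sym (*-identityˡ N))) (average-cross-≤ c R N X Y X≤)

  ∈⇒≤sum : ∀ {x xs} → x ∈ xs → x ≤ sum xs
  ∈⇒≤sum {xs = x ∷ xs} (here refl)  = m≤m+n x (sum xs)
  ∈⇒≤sum {xs = x ∷ xs} (there x∈xs) = ≤-trans (∈⇒≤sum x∈xs) (m≤n+m (sum xs) x)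

  1≤T : ∀ {κ} I → StandingAssumptions κ I → 1 ≤ Instance.T I
  1≤T I A with StandingAssumptions.min-p A
  ... | j , p≡1 = begin
    1          ≡⟨ p≡1 ⟨
    p j        ≤⟨ ∈⇒≤sum (∈-map⁺ p (∈-allFin j)) ⟩
    ∑p         ≤⟨ m≤n+m ∑p rmax ⟩
    rmax + ∑p  ∎
    where
    open Instance I
    open ≤-Reasoning

  -- Doubling the bound `12` on the overruns gives the final constant `24`. Only the main term
  -- carries the factor `N`, so after averaging the error is `24 / N` relative to it.
  Σ<-weighted-≤ : ∀ R N w m (G : ℕ → ℕ → ℕ) → Σ< R (λ a → Σ< N (G a)) ≤ 12 * (R * m) →
    Σ< R (λ a → Σ< N (λ b → w * (m + 2 * G a b))) ≤ (R * N + 24 * R) * (w * m)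
  Σ<-weighted-≤ R N w m G G≤ = begin
    Σ< R (λ a → Σ< N (λ b → w * (m + 2 * G a b)))
      ≡⟨ Σ<-cong R (λ a _ → inner a) ⟩
    Σ< R (λ a → w * (N * m + 2 * Σ< N (G a)))
      ≡⟨ Σ<-distrib-* R w _ ⟩
    w * Σ< R (λ a → N * m + 2 * Σ< N (G a))
      ≡⟨ cong (w *_) (trans (Σ<-distrib-+ R _ _) (cong₂ _+_ (Σ<-const R (N * m)) (Σ<-distrib-* R 2 _))) ⟩
    w * (R * (N * m) + 2 * Σ< R (λ a → Σ< N (G a)))
      ≤⟨ *-monoʳ-≤ w (+-monoʳ-≤ (R * (N * m)) (*-monoʳ-≤ 2 G≤)) ⟩
    w * (R * (N * m) + 2 * (12 * (R * m)))
      ≡⟨ shift R N w m ⟩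
    (R * N + 24 * R) * (w * m) ∎
    where
    open ≤-Reasoning
    inner : ∀ a → Σ< N (λ b → w * (m + 2 * G a b)) ≡ w * (N * m + 2 * Σ< N (G a))
    inner a = trans (Σ<-distrib-* N w _) (cong (w *_)
      (trans (Σ<-distrib-+ N _ _) (cong₂ _+_ (Σ<-const N m) (Σ<-distrib-* N 2 (G a)))))
    shift : ∀ R N w m → w * (R * (N * m) + 2 * (12 * (R * m))) ≡ (R * N + 24 * R) * (w * m)
    shift = solve-∀

  module _ (N : ℕ) .{{_ : NonTrivial N}} where

    instance
      N≢0 : NonZero N
      N≢0 = nonTrivial⇒nonZero N
      D≢0 : NonZero (2/ε N)
      D≢0 = m*n≢0 2 N
      K≢0 : NonZero (K N)
      K≢0 = m^n≢0 (2/ε N) N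

    TK≤K^ℓmax∸1 : ∀ T l → T * K N ^ 2 ≤ K N ^ suc l → T * K N ≤ K N ^ l
    TK≤K^ℓmax∸1 T l TK²≤ = *-cancelˡ-≤ (K N) (≤-trans (≤-reflexive (shift T (K N))) TK²≤)
      where
      shift : ∀ T K → K * (T * K) ≡ T * (K * (K * 1))
      shift = solve-∀

    -- For `ℓmax = 0` the defining inequality would read `T * K N ^ 2 ≤ 1`, contradicting `2 ≤ K N`.
    -- So `ℓmax` is a successor, and `ℓmax ∸ 1` is not truncated.
    ℓmax≢0 : ∀ T → 1 ≤ T → ¬ (T * K N ^ 2 ≤ 1)
    ℓmax≢0 T 1≤T TK²≤1 = contradiction (begin
      2          ≤⟨ 2≤[2n]^n N ⟩
      K N        ≤⟨ m≤m^n (K N) 2 ⟩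
      K N ^ 2    ≤⟨ m≤n*m (K N ^ 2) T {{>-nonZero 1≤T}} ⟩
      T * K N ^ 2 ≤⟨ TK²≤1 ⟩
      1          ∎) λ { (s≤s ()) }
      where
      open ≤-Reasoning
      m≤m^n : ∀ m n .{{_ : NonZero m}} .{{_ : NonZero n}} → m ≤ m ^ n
      m≤m^n m (suc n) = m≤m*n m (m ^ n) {{m^n≢0 m n}}

    module _ (I : Instance) (l : ℕ) (m : Fin (Instance.n I) → ℕ) where

      open Instance I

      offsets = cartesianProduct (allFin (K N ^ l)) (allFin N)

      overrun : Offsets N (suc l) → Fin n → ℕ
      overrun o = Rounding.overrun N l o I m

      R : ℕ
      R = K N ^ l

      ∑-job-≤ : 1 ≤ T → T * K N ≤ R → ∀ j → 1 ≤ m j → r j + m j ≤ suc T →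
        ∑ offsets (λ o → + (w j * (m j + 2 * overrun o j))) ℤ.≤ + (R * N + 24 * R) ℤ.* + (w j * m j)
      ∑-job-≤ 1≤T TK≤R j 1≤m r+m≤ = begin
        ∑ offsets (λ o → + (w j * (m j + 2 * overrun o j)))
          ≡⟨ ∑-cartesianProduct (allFin R) (allFin N) _ ⟩
        ∑ (allFin R) (λ a → ∑ (allFin N) (λ b → + (w j * (m j + 2 * overrun (a , b) j))))
          -- For the offsets numbered `a` and `b`, `overrun` unfolds to `G a b`, so `refl` suffices.
          ≡⟨ ∑-tabulate R id (λ a → ∑-tabulate N id (λ b → refl)) ⟩
        + Σ< R (λ a → Σ< N (λ b → w j * (m j + 2 * G a b)))
          ≤⟨ ℤ.+≤+ (Σ<-weighted-≤ R N (w j) (m j) G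
              (Σ<-below-endDist-grid N (nonTrivial⇒n>1 N) T l 1≤T TK≤R L≢0 (r j) (m j) 1≤m r+m≤)) ⟩
        + ((R * N + 24 * R) * (w j * m j))
          ≡⟨ ℤ.pos-* (R * N + 24 * R) (w j * m j) ⟩
        + (R * N + 24 * R) ℤ.* + (w j * m j) ∎
        where
        open ℤ.≤-Reasoning
        L≢0 : ∀ b h → NonZero ((2 * N) ^ b * K N ^ h)
        L≢0 b h = m*n≢0 ((2 * N) ^ b) (K N ^ h) {{m^n≢0 (2 * N) b}} {{m^n≢0 (K N) h}}
        G : ℕ → ℕ → ℕ
        G a b = Σ< (suc l) λ h → below (m j) (Endpoints.endDist (λ h → (2 * N) ^ b * K N ^ h) (L≢0 b) (r j + a) (suc h))
    -- One optimal solution of (IP) is rounded for every offset pair, and each rounding bounds the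
    -- optimum of (IP2) for that pair. Exchanging the sums, which is linearity of expectation,
    -- leaves a bound for each job separately.
    ∑-OPT-IP2-≤ : ∀ {κ} I l → StandingAssumptions κ I → Instance.T I * K N ≤ K N ^ l →
      ∀ OPT-IP (OPT-IP2 : Offsets N (suc l) → ℤ) → IsOPT (IP I) OPT-IP →
      (∀ o → IsOPT (IP2 N I (suc l) o) (OPT-IP2 o)) →
      ∑ (cartesianProduct (allFin (K N ^ l)) (allFin N)) OPT-IP2 ℤ.≤ + (K N ^ l * N + 24 * K N ^ l) ℤ.* OPT-IP
    ∑-OPT-IP2-≤ I l A TK≤R OPT-IP OPT-IP2 ((x , feasible , cost≡) , _) isOPT2 = begin
      ∑ os OPT-IP2
        ≤⟨ ∑-mono os (λ {o} _ → ℤ.≤-trans (proj₂ (isOPT2 o) (y o) (feasible-y o (m≤ o) x feasible running⇒<)) (cost-y o (m≤ o))) ⟩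
      ∑ os (λ o → ∑ J (λ j → + (w j * (duration j + 2 * overrun I l duration o j))))
        ≡⟨ ∑-comm os J _ ⟩
      ∑ J (λ j → ∑ os (λ o → + (w j * (duration j + 2 * overrun I l duration o j))))
        ≤⟨ ∑-mono J (λ {j} _ → ∑-job-≤ I l duration (1≤T I A) TK≤R j (1≤duration j) (r+duration≤1+T j)) ⟩
      ∑ J (λ j → + (K N ^ l * N + 24 * K N ^ l) ℤ.* + (w j * duration j))
        ≡⟨ ∑-distrib-* J (+ (K N ^ l * N + 24 * K N ^ l)) _ ⟩
      + (K N ^ l * N + 24 * K N ^ l) ℤ.* ∑ J (λ j → + (w j * duration j))
        ≡⟨ cong (+ (K N ^ l * N + 24 * K N ^ l) ℤ.*_) (trans (sym cost-IP) cost≡) ⟩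
      + (K N ^ l * N + 24 * K N ^ l) ℤ.* OPT-IP ∎
      where
      open ℤ.≤-Reasoning
      open Instance I
      open Schedule I (StandingAssumptions.p≥1 A) x feasible
      os = cartesianProduct (allFin (K N ^ l)) (allFin N)
      open module Round (o : Offsets N (suc l)) = Rounding N l o I duration
        using (y; cost-y; feasible-y; m≤dist; dist)
      m≤ : ∀ o j → duration j ≤ dist o j (2 + l)
      m≤ o j = m≤dist o j (1≤T I A) TK≤R (r+duration≤1+T j)

    𝔼-OPT-IP2-≤ : ∀ {κ} I ℓmax → StandingAssumptions κ I → IsLMax N (Instance.T I) ℓmax →
      ∀ OPT-IP (OPT-IP2 : Offsets N ℓmax → ℤ) → IsOPT (IP I) OPT-IP →
      (∀ o → IsOPT (IP2 N I ℓmax o) (OPT-IP2 o)) →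
      𝔼 N ℓmax OPT-IP2 ℚ.≤ (ℚ.1ℚ ℚ.+ (+ 24 ℚ./ 1) ℚ.* ε N) ℚ.* (OPT-IP ℚ./ 1)
    𝔼-OPT-IP2-≤ I zero    A (TK²≤ , _) _ _ _ _ = contradiction TK²≤ (ℓmax≢0 (Instance.T I) (1≤T I A))
    𝔼-OPT-IP2-≤ I (suc l) A (TK²≤ , _) OPT-IP OPT-IP2 isOPT isOPT2 =
      average-≤ 24 (K N ^ l) N {{m^n≢0 (K N) l}} {{N≢0}} {{m*n≢0 (K N ^ l) N {{m^n≢0 (K N) l}}}} (∑ (cartesianProduct (allFin (K N ^ l)) (allFin N)) OPT-IP2) OPT-IP
        (∑-OPT-IP2-≤ I l A (TK≤K^ℓmax∸1 (Instance.T I) l TK²≤) OPT-IP OPT-IP2 isOPT isOPT2)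

open import Data.Product.Base using (∃-syntax; _,_)
open import Data.Rational.Base using (1ℚ; _+_; _*_; _/_; _≤_)

lemma5 : ∃[ c ] ∀ (1/ε : ℕ) .{{_ : NonTrivial 1/ε}} (κ : ℕ) (I : Instance) (ℓmax : ℕ) →
    StandingAssumptions κ I →
    IsLMax 1/ε (Instance.T I) ℓmax →
    ∀ (OPT-IP : ℤ) (OPT-IP2 : Offsets 1/ε ℓmax → ℤ) →
    IsOPT (IP I) OPT-IP →
    (∀ o → IsOPT (IP2 1/ε I ℓmax o) (OPT-IP2 o)) →
    𝔼 1/ε ℓmax OPT-IP2 ≤ (1ℚ + (+ c / 1) * ε 1/ε) * (OPT-IP / 1)
lemma5 = 24 , λ 1/ε κ I ℓmax → Expectation.𝔼-OPT-IP2-≤ 1/ε I ℓmax
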